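{- For every integer $n\geq 1$, $$cr(K_{n,n}-nK_2)\leq \left\lfloor\frac{n}{2}\right\rfloor\left\lfloor\frac{n-1}{2}\right\rfloor\left\lfloor\frac{n-2}{2}\right\rfloor\left\lfloor\frac{n-3}{2}\right\rfloor .$$
   Context: The crossing number $cr(G)$ of a graph $G$ is the smallest number of pairwise crossings of edges among all drawings of $G$ in the plane. The graph $K_{n,n}-nK_2$ (the complete bipartite graph minus a perfect matching) has vertex set $\{a_i,b_i : 0\leq i\leq n-1\}$ and edge set $\{(a_i,b_j) : 0\leq i\neq j\leq n-1\}$. -}

module Defs where

open import Algebra.Bundles using (CommutativeRing)
open import Axiom.ExcludedMiddle using (ExcludedMiddle)
open import Data.Fin.Base using (Fin)
open import Data.Nat.Base as ℕ using (ℕ)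
open import Data.Nat.Induction using (<-rec)
open import Data.Nat.Properties using (≮⇒≥)
open import Data.Product.Base using (Σ-syntax; ∃; ∃-syntax; _×_; _,_; proj₁; proj₂; swap)
open import Data.Sum.Base using (_⊎_; inj₁; inj₂)
open import Function.Definitions using (Injective; StrictlySurjective)
open import Level using (0ℓ; suc)
open import Relation.Binary.Core using (Rel)
open import Relation.Binary.PropositionalEquality.Core using (_≡_; _≢_; refl)
open import Relation.Binary.Structures using (IsStrictTotalOrder)
open import Relation.Nullary.Decidable.Core using (yes; no)
open import Relation.Nullary.Negation.Core using (¬_)

-- The classical axioms of ℝ, a Dedekind-complete totally ordered field, which
-- determine it up to isomorphism.  Equality is a setoid equality, as in
-- CommutativeRing.

record RealField : Set (suc 0ℓ) where
  infix 4 _<_ _≤_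
  field
    commutativeRing : CommutativeRing 0ℓ 0ℓ

  open CommutativeRing commutativeRing public

  field
    _<_                : Rel Carrier 0ℓ
    isStrictTotalOrder : IsStrictTotalOrder _≈_ _<_
    0<1                : 0# < 1#
    +-monoˡ-<          : ∀ {x y} z → x < y → x + z < y + z
    *-pos              : ∀ {x y} → 0# < x → 0# < y → 0# < x * y
    inverse            : ∀ x → ¬ (x ≈ 0#) → ∃[ y ] x * y ≈ 1#

  _≤_ : Rel Carrier 0ℓ
  x ≤ y = x < y ⊎ x ≈ y

  IsUpperBound : (Carrier → Set) → Carrier → Set
  IsUpperBound P u = ∀ x → P x → x ≤ u

  field
    supremum : ∀ (P : Carrier → Set) → ∃ P → ∃ (IsUpperBound P) →
               ∃[ s ] IsUpperBound P s × (∀ u → IsUpperBound P u → s ≤ u)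

-- Simple graphs.  `ends` orients every edge, but only so that the arc drawn for
-- it can be given a starting point.

record Graph : Set (suc 0ℓ) where
  field
    Vertex   : Set
    Edge     : Set
    ends     : Edge → Vertex × Vertex
    loopless : ∀ e → proj₁ (ends e) ≢ proj₂ (ends e)
    simple   : ∀ e f → ends e ≡ ends f ⊎ ends e ≡ swap (ends f) → e ≡ f

module _ (ℝ : RealField) where
  open RealField ℝ using (Carrier; _≈_; _<_; _≤_; _-_; 0#; 1#)

  Plane : Set
  Plane = Carrier × Carrier

  infix 4 _≋_
  _≋_ : Rel Plane 0ℓ
  (x , y) ≋ (x′ , y′) = x ≈ x′ × y ≈ y′

  Near : Carrier → Rel Carrier 0ℓ
  Near ε x y = (x - y < ε) × (y - x < ε)

  -- Distance below ε in the maximum norm, which induces the usual topology.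
  Near² : Carrier → Rel Plane 0ℓ
  Near² ε (x , y) (x′ , y′) = Near ε x x′ × Near ε y y′

  [0,1] : Carrier → Set
  [0,1] t = 0# ≤ t × t ≤ 1#

  ]0,1[ : Carrier → Set
  ]0,1[ t = 0# < t × t < 1#

  ContinuousOn[0,1] : (Carrier → Plane) → Set
  ContinuousOn[0,1] γ =
    ∀ s → [0,1] s → ∀ ε → 0# < ε →
    ∃[ δ ] 0# < δ × (∀ t → [0,1] t → Near δ s t → Near² ε (γ s) (γ t))

  -- Only the values of an arc on [0,1] matter.
  record Drawing (G : Graph) : Set where
    open Graph G
    field
      point            : Vertex → Plane
      point-injective  : Injective _≡_ _≋_ point
      arc              : Edge → Carrier → Plane
      arc-continuous   : ∀ e → ContinuousOn[0,1] (arc e)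
      arc-injective    : ∀ e s t → [0,1] s → [0,1] t → arc e s ≋ arc e t → s ≈ t
      arc-start        : ∀ e → arc e 0# ≋ point (proj₁ (ends e))
      arc-end          : ∀ e → arc e 1# ≋ point (proj₂ (ends e))
      arc-avoids-point : ∀ e t → ]0,1[ t → ∀ v → ¬ (arc e t ≋ point v)

  module _ {G : Graph} (D : Drawing G) where
    open Graph G
    open Drawing D

    -- Any common interior point of two distinct edges.  A tangency thus counts
    -- as a crossing, and a point interior to k edges accounts for one crossing
    -- per pair of them; neither convention affects the minimum.
    record Crossing : Set where
      field
        e f   : Edge
        e≢f   : e ≢ f
        s t   : Carrier
        s∈    : ]0,1[ s
        t∈    : ]0,1[ t
        meet  : arc e s ≋ arc f t

    open Crossing

    -- Same unordered pair of edges, same point of the plane.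
    SameCrossing : Rel Crossing 0ℓ
    SameCrossing x y =
      ((e x ≡ e y × f x ≡ f y) ⊎ (e x ≡ f y × f x ≡ e y)) ×
      arc (e x) (s x) ≋ arc (e y) (s y)

    HasCrossings : ℕ → Set
    HasCrossings k =
      Σ[ c ∈ (Fin k → Crossing) ]
        Injective _≡_ SameCrossing c × StrictlySurjective SameCrossing c

  -- Drawings with infinitely many crossings do not compete for the minimum.
  record IsCrossingNumber (G : Graph) (c : ℕ) : Set where
    field
      attained : Σ[ D ∈ Drawing G ] HasCrossings D c
      minimal  : ∀ (D : Drawing G) k → HasCrossings D k → c ℕ.≤ k

  -- Selecting the least element of an inhabited set of naturals is not
  -- constructive, so "cr(G) ≤ b" comprises a drawing with at most b crossings
  -- as well as the bound on the crossing number itself.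
  record CrossingNumberAtMost (G : Graph) (b : ℕ) : Set where
    field
      drawing : Σ[ D ∈ Drawing G ] ∃[ k ] HasCrossings D k × k ℕ.≤ b
      bound   : ∀ c → IsCrossingNumber G c → c ℕ.≤ b

  -- With excluded middle it is the literal reading: cr(G) exists and is ≤ b.
  crossingNumber : ExcludedMiddle 0ℓ → ∀ {G b} → CrossingNumberAtMost G b →
                   ∃[ c ] IsCrossingNumber G c × c ℕ.≤ b
  crossingNumber em {G} atMost with CrossingNumberAtMost.drawing atMost
  ... | D , k , h , _ = let c , isCr = least k (D , h) in
                        c , isCr , CrossingNumberAtMost.bound atMost c isCr
    where
    Drawable : ℕ → Set
    Drawable k = Σ[ D ∈ Drawing G ] HasCrossings D k

    least : ∀ k → Drawable k → ∃ (IsCrossingNumber G)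
    least = <-rec _ step
      where
      step : ∀ k → (∀ {j} → j ℕ.< k → Drawable j → ∃ (IsCrossingNumber G)) →
             Drawable k → ∃ (IsCrossingNumber G)
      step k rec d with em {∃[ j ] j ℕ.< k × Drawable j}
      ... | yes (j , j<k , d′) = rec j<k d′
      ... | no none = k , record
        { attained = d
        ; minimal  = λ D j h → ≮⇒≥ (λ j<k → none (j , j<k , D , h))
        }

data KVertex (n : ℕ) : Set where
  a b : Fin n → KVertex n

-- The proof of i ≢ j is irrelevant, so an edge is determined by i and j.
record KEdge (n : ℕ) : Set where
  constructor edge
  field
    i j  : Fin n
    .i≢j : i ≢ j

Kₙₙ-nK₂ : ℕ → Graph
Kₙₙ-nK₂ n = record
  { Vertex   = KVertex n
  ; Edge     = KEdge n
  ; ends     = λ (edge i j _) → a i , b j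
  ; loopless = λ _ ()
  ; simple   = λ { _ _ (inj₁ refl) → refl ; _ _ (inj₂ ()) }
  }

module Submission where

-- All vertices lie on the x-axis and every edge crosses the axis exactly once, so that it
-- consists of one arc below the axis and one above.  The arcs are taken from the parabolas
-- y = ± (x - l) (h - x): the difference of two of them is linear in x, so two arcs on the
-- same side meet exactly when the intervals [l, h] interleave, and then once.
--
-- From left to right the axis carries a western cluster (a_i for odd i, b_j for even j),
-- some crossing points, an eastern cluster (a_i for even i, b_j for odd j) and further
-- crossing points.  Edges inside the eastern cluster run above it, those inside the western
-- cluster below it.  Any other edge leaves the eastern cluster below the axis and enters the
-- western one from above, passing between the clusters if its eastern index is the smaller
-- one, and around the eastern cluster otherwise.  The crossings then correspond to the
-- quadruples of indices h < i < j < k with parities pqqp, ppqq or p q 1-p 1-q, two for each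
-- quadruple and pattern, and there are as many of these as the bound says.

-- A value of `HasCrossings` enumerates all crossings exactly and without repetition, while only an
-- upper bound is wanted. A transversal modulo `SameCrossing` then yields the exact number, which is
-- at most the length of the list. Trichotomy of the order makes equality of points decidable, hence
-- also `SameCrossing`. Parabolas, unlike semicircles, can be traversed and intersected with field
-- operations alone: a meeting point is a quotient, and no square root has to be built. All
-- positions on the axis are natural numbers, so comparisons of naturals decide which arcs cross.
-- The three parity patterns allow twelve words, but only six distinct ones, each arising from two
-- patterns: 0000, 1111, 0011, 1100, 0110, 1001. With two crossings per quadruple and pattern, the
-- total is four times the number of quadruples with such a word; removing the largest member gives
-- recursions for that number.

open import Defs
import Algebra.Properties.AbelianGroup as AbelianGroupProperties
import Algebra.Properties.Ring as RingProperties
import Algebra.Properties.Semiring.Mult.TCOptimised as SemiringMult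
import Algebra.Solver.Ring as RingSolver
open import Algebra.Solver.Ring.AlmostCommutativeRing using (fromCommutativeRing; _-Raw-AlmostCommutative⟶_)
open import Data.Bool.Base using (Bool; true; false; not; if_then_else_)
open import Data.Empty using (⊥; ⊥-elim-irr)
open import Data.Fin.Base using (Fin; zero; suc; toℕ; fromℕ<)
import Data.Fin.Properties as Fin
open import Data.Integer.Base as ℤ using (ℤ)
import Data.Integer.Properties as ℤ
open import Data.List.Base using (List; []; _∷_; _++_; length; map; concatMap; mapMaybe)
import Data.List.Properties as List
open import Data.List.Membership.Propositional using (_∈_)
open import Data.List.Membership.Propositional.Properties using (∈-++⁺ˡ; ∈-++⁺ʳ; ∈-map⁺)
open import Data.List.Relation.Unary.Any using (here; there)
open import Data.Maybe.Base using (Maybe; just; nothing)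
import Data.Maybe.Properties as Maybe
open import Data.Nat.Base as ℕ using (ℕ; zero; suc; parity)
import Data.Nat.Properties as ℕ
open import Data.Nat.Tactic.RingSolver using (solve-∀)
open import Data.Parity.Base using (Parity; 0ℙ; 1ℙ; _⁻¹)
open import Data.Product.Base using (Σ-syntax; ∃-syntax; _×_; _,_; proj₁; proj₂)
open import Data.Sum.Base using (_⊎_; inj₁; inj₂)
open import Data.Unit.Base using (⊤; tt)
open import Function.Definitions using (Injective)
open import Level using (0ℓ)
open import Relation.Binary.Core using (Rel)
open import Relation.Binary.Definitions using (tri<; tri≈; tri>; Decidable; DecidableEquality; Symmetric; Transitive)
open import Relation.Binary.PropositionalEquality.Core as ≡ using (_≡_; _≢_)
open import Relation.Binary.PropositionalEquality.Properties using (module ≡-Reasoning)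
open import Relation.Binary.Structures using (IsStrictTotalOrder)
open import Relation.Nullary.Decidable.Core using (Dec; yes; no; does; _×-dec_; _⊎-dec_)
open import Relation.Nullary.Negation.Core using (¬_; contradiction)

-- Ring normalisation over the real field, with integer coefficients.

module IntegerCoefficients (ℝ : RealField) where
  open import Data.Integer.Base using (+_; -[1+_])
  open RealField ℝ
  open RingProperties ring using (-‿distribˡ-*; -‿distribʳ-*; -‿involutive)
  open AbelianGroupProperties +-abelianGroup using (ε⁻¹≈ε; ⁻¹-∙-comm)
  open SemiringMult semiring using (×-homo-+; ×1-homo-*; 1+×) renaming (_×_ to _⋆_)
  open import Relation.Binary.Reasoning.Setoid setoid

  -- The optimised multiple reduces `1 ⋆ 1#` to `1#`, so that the solver's `:1` is `1#` on the nose;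
  -- `1+fromℕ` restores the recursion that this costs.
  fromℕ : ℕ → Carrier
  fromℕ n = n ⋆ 1#

  1+fromℕ : ∀ n → fromℕ (suc n) ≈ 1# + fromℕ n
  1+fromℕ n = 1+× n 1#

  fromℤ : ℤ → Carrier
  fromℤ (+ n)    = fromℕ n
  fromℤ -[1+ n ] = - fromℕ (suc n)

  cancel-suc : ∀ x y → (1# + x) - (1# + y) ≈ x - y
  cancel-suc x y = begin
    (1# + x) - (1# + y)      ≈⟨ +-congˡ (⁻¹-∙-comm 1# y) ⟨
    (1# + x) + (- 1# - y)    ≈⟨ +-congʳ (+-comm 1# x) ⟩
    (x + 1#) + (- 1# - y)    ≈⟨ +-assoc x 1# (- 1# - y) ⟩
    x + (1# + (- 1# - y))    ≈⟨ +-congˡ (+-assoc 1# (- 1#) (- y)) ⟨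
    x + ((1# - 1#) - y)      ≈⟨ +-congˡ (+-congʳ (-‿inverseʳ 1#)) ⟩
    x + (0# - y)             ≈⟨ +-congˡ (+-identityˡ (- y)) ⟩
    x - y                    ∎

  fromℤ-⊖ : ∀ m n → fromℤ (m ℤ.⊖ n) ≈ fromℕ m - fromℕ n
  fromℤ-⊖ zero    zero    = sym (-‿inverseʳ 0#)
  fromℤ-⊖ zero    (suc n) = sym (+-identityˡ _)
  fromℤ-⊖ (suc m) zero    = sym (trans (+-congˡ ε⁻¹≈ε) (+-identityʳ _))
  fromℤ-⊖ (suc m) (suc n) = begin
    fromℤ (suc m ℤ.⊖ suc n)      ≡⟨ ≡.cong fromℤ (ℤ.[1+m]⊖[1+n]≡m⊖n m n) ⟩
    fromℤ (m ℤ.⊖ n)              ≈⟨ fromℤ-⊖ m n ⟩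
    fromℕ m - fromℕ n                  ≈⟨ cancel-suc (fromℕ m) (fromℕ n) ⟨
    (1# + fromℕ m) - (1# + fromℕ n)    ≈⟨ +-cong (1+fromℕ m) (-‿cong (1+fromℕ n)) ⟨
    fromℕ (suc m) - fromℕ (suc n)      ∎

  fromℤ-+ : ∀ i j → fromℤ (i ℤ.+ j) ≈ fromℤ i + fromℤ j
  fromℤ-+ (+ m)    (+ n)    = ×-homo-+ 1# m n
  fromℤ-+ (+ m)    -[1+ n ] = fromℤ-⊖ m (suc n)
  fromℤ-+ -[1+ m ] (+ n)    = trans (fromℤ-⊖ n (suc m)) (+-comm _ _)
  fromℤ-+ -[1+ m ] -[1+ n ] = begin
    - fromℕ (suc (suc (m ℕ.+ n)))          ≡⟨ ≡.cong (λ k → - fromℕ (suc k)) (≡.sym (ℕ.+-suc m n)) ⟩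
    - fromℕ (suc m ℕ.+ suc n)              ≈⟨ -‿cong (×-homo-+ 1# (suc m) (suc n)) ⟩
    - (fromℕ (suc m) + fromℕ (suc n))      ≈⟨ ⁻¹-∙-comm _ _ ⟨
    - fromℕ (suc m) + - fromℕ (suc n)      ∎

  fromℤ-neg : ∀ i → fromℤ (ℤ.- i) ≈ - fromℤ i
  fromℤ-neg (+ zero)  = sym ε⁻¹≈ε
  fromℤ-neg (+ suc n) = refl
  fromℤ-neg -[1+ n ]  = sym (-‿involutive _)

  fromℤ-* : ∀ i j → fromℤ (i ℤ.* j) ≈ fromℤ i * fromℤ j
  fromℤ-* (+ m) (+ n) = trans (reflexive (≡.cong fromℤ (≡.sym (ℤ.pos-* m n)))) (×1-homo-* m n)
  fromℤ-* (+ m) -[1+ n ] = begin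
    fromℤ (+ m ℤ.* -[1+ n ])               ≡⟨ ≡.cong fromℤ (≡.sym (ℤ.neg-distribʳ-* (+ m) (+ suc n))) ⟩
    fromℤ (ℤ.- (+ m ℤ.* + suc n))          ≈⟨ fromℤ-neg (+ m ℤ.* + suc n) ⟩
    - fromℤ (+ m ℤ.* + suc n)              ≈⟨ -‿cong (fromℤ-* (+ m) (+ suc n)) ⟩
    - (fromℕ m * fromℕ (suc n))            ≈⟨ -‿distribʳ-* _ _ ⟩
    fromℕ m * - fromℕ (suc n)              ∎
  fromℤ-* -[1+ m ] (+ n) = begin
    fromℤ (-[1+ m ] ℤ.* + n)               ≡⟨ ≡.cong fromℤ (≡.sym (ℤ.neg-distribˡ-* (+ suc m) (+ n))) ⟩
    fromℤ (ℤ.- (+ suc m ℤ.* + n))          ≈⟨ fromℤ-neg (+ suc m ℤ.* + n) ⟩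
    - fromℤ (+ suc m ℤ.* + n)              ≈⟨ -‿cong (fromℤ-* (+ suc m) (+ n)) ⟩
    - (fromℕ (suc m) * fromℕ n)            ≈⟨ -‿distribˡ-* _ _ ⟩
    - fromℕ (suc m) * fromℕ n              ∎
  fromℤ-* -[1+ m ] -[1+ n ] = begin
    fromℕ (suc m ℕ.* suc n)                ≈⟨ ×1-homo-* (suc m) (suc n) ⟩
    fromℕ (suc m) * fromℕ (suc n)          ≈⟨ -‿involutive _ ⟨
    - - (fromℕ (suc m) * fromℕ (suc n))    ≈⟨ -‿cong (-‿distribʳ-* _ _) ⟩
    - (fromℕ (suc m) * - fromℕ (suc n))    ≈⟨ -‿distribˡ-* _ _ ⟩
    - fromℕ (suc m) * - fromℕ (suc n)      ∎

  fromℤ-morphism : ℤ.+-*-rawRing -Raw-AlmostCommutative⟶ fromCommutativeRing commutativeRing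
  fromℤ-morphism = record
    { ⟦_⟧    = fromℤ
    ; +-homo = fromℤ-+
    ; *-homo = fromℤ-*
    ; -‿homo = fromℤ-neg
    ; 0-homo = refl
    ; 1-homo = refl
    }

  fromℤ-≟ : ∀ i j → Maybe (fromℤ i ≈ fromℤ j)
  fromℤ-≟ i j with i ℤ.≟ j
  ... | yes i≡j = just (reflexive (≡.cong fromℤ i≡j))
  ... | no  _   = nothing

  open RingSolver ℤ.+-*-rawRing (fromCommutativeRing commutativeRing) fromℤ-morphism fromℤ-≟ public
    using (Polynomial; solve; con; _:+_; _:*_; _:-_; :-_; _:=_)

  :0 :1 : ∀ {n} → Polynomial n
  :0 = con (+ 0)
  :1 = con (+ 1)

-- Order and cancellation in the real field.

module OrderedField (ℝ : RealField) where
  open RealField ℝ public hiding (zero)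
  open IntegerCoefficients ℝ public
    using (fromℕ; 1+fromℕ; Polynomial; solve; con; _:+_; _:*_; _:-_; :-_; _:=_; :0; :1)
  open IsStrictTotalOrder isStrictTotalOrder public
    using (compare; <-respˡ-≈; <-respʳ-≈; _≟_) renaming (trans to <-trans; irrefl to <-irrefl; asym to <-asym)

  0<-resp : ∀ {x y} → x ≈ y → 0# < x → 0# < y
  0<-resp = <-respʳ-≈

  0<y-x : ∀ {x y} → x < y → 0# < y - x
  0<y-x {x} {y} x<y = <-respˡ-≈ (-‿inverseʳ x) (+-monoˡ-< (- x) x<y)

  -- Most inequalities are proved in this form: the ring solver rewrites the difference as a
  -- combination of terms already known to be positive.
  0<y-x⇒x<y : ∀ {x y} → 0# < y - x → x < y
  0<y-x⇒x<y {x} {y} p =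
    <-respˡ-≈ (+-identityˡ x)
      (<-respʳ-≈ (solve 2 (λ x y → (y :- x) :+ x := y) refl x y) (+-monoˡ-< x p))

  +-pos : ∀ {x y} → 0# < x → 0# < y → 0# < x + y
  +-pos {x} {y} 0<x 0<y = <-trans 0<y (<-respˡ-≈ (+-identityˡ y) (+-monoˡ-< y 0<x))

  +-mono-< : ∀ {x y u v} → x < y → u < v → x + u < y + v
  +-mono-< {x} {y} {u} {v} x<y u<v = 0<y-x⇒x<y
    (0<-resp (solve 4 (λ x y u v → (y :- x) :+ (v :- u) := (y :+ v) :- (x :+ u)) refl x y u v)
      (+-pos (0<y-x x<y) (0<y-x u<v)))

  neg-< : ∀ {x y} → x < y → - y < - x
  neg-< {x} {y} x<y = 0<y-x⇒x<y
    (0<-resp (solve 2 (λ x y → y :- x := (:- x) :- (:- y)) refl x y) (0<y-x x<y))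

  x<0⇒0<-x : ∀ {x} → x < 0# → 0# < - x
  x<0⇒0<-x x<0 = 0<-resp (+-identityˡ _) (0<y-x x<0)

  0<-x⇒x<0 : ∀ {x} → 0# < - x → x < 0#
  0<-x⇒x<0 p = 0<y-x⇒x<y (0<-resp (sym (+-identityˡ _)) p)

  ≈0⇒≯0 : ∀ {x} → x ≈ 0# → ¬ (0# < x)
  ≈0⇒≯0 x≈0 0<x = <-irrefl (sym x≈0) 0<x

  x-y≈0⇒x≈y : ∀ {x y} → x - y ≈ 0# → x ≈ y
  x-y≈0⇒x≈y {x} {y} p =
    trans (solve 2 (λ x y → x := (x :- y) :+ y) refl x y) (trans (+-congʳ p) (+-identityˡ y))

  x≈y⇒x-y≈0 : ∀ {x y} → x ≈ y → x - y ≈ 0#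
  x≈y⇒x-y≈0 {x} {y} p = trans (+-congʳ p) (-‿inverseʳ y)

  double-pos : ∀ {x} → 0# < x + x → 0# < x
  double-pos {x} p with compare 0# x
  ... | tri< 0<x _ _ = 0<x
  ... | tri≈ _ 0≈x _ = contradiction p (≈0⇒≯0 (trans (+-cong (sym 0≈x) (sym 0≈x)) (+-identityʳ 0#)))
  ... | tri> _ _ x<0 = contradiction p λ q →
    <-asym q (<-respʳ-≈ (+-identityʳ 0#) (+-mono-< x<0 x<0))

  *-cancelˡ-pos : ∀ {x y} → 0# < x → 0# < x * y → 0# < y
  *-cancelˡ-pos {x} {y} 0<x 0<xy with compare 0# y
  ... | tri< 0<y _ _ = 0<y
  ... | tri≈ _ 0≈y _ = contradiction 0<xy (≈0⇒≯0 (trans (*-congˡ (sym 0≈y)) (zeroʳ x)))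
  ... | tri> _ _ y<0 = contradiction 0<xy λ q →
    <-asym q (0<-x⇒x<0 (0<-resp (solve 2 (λ x y → x :* (:- y) := :- (x :* y)) refl x y)
      (*-pos 0<x (x<0⇒0<-x y<0))))

  x*y≈0⇒y≈0 : ∀ {x y} → ¬ (x ≈ 0#) → x * y ≈ 0# → y ≈ 0#
  x*y≈0⇒y≈0 {x} {y} x≉0 xy≈0 = let z , xz≈1 = inverse x x≉0 in
    trans (sym (*-identityˡ y)) (trans (*-congʳ (sym xz≈1))
      (trans (solve 3 (λ x y z → (x :* z) :* y := z :* (x :* y)) refl x y z)
        (trans (*-congˡ xy≈0) (zeroʳ z))))

  *-cancelˡ : ∀ {x y z} → ¬ (x ≈ 0#) → x * y ≈ x * z → y ≈ z
  *-cancelˡ {x} {y} {z} x≉0 p = x-y≈0⇒x≈y (x*y≈0⇒y≈0 x≉0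
    (trans (solve 3 (λ x y z → x :* (y :- z) := x :* y :- x :* z) refl x y z) (x≈y⇒x-y≈0 p)))

  >⇒≉0 : ∀ {x} → 0# < x → ¬ (x ≈ 0#)
  >⇒≉0 0<x x≈0 = ≈0⇒≯0 x≈0 0<x

  fromℕ-mono : ∀ {m n} → m ℕ.< n → fromℕ m < fromℕ n
  fromℕ-mono {m} m<n = go (ℕ.≤⇒≤′ m<n)
    where
    x<1+x : ∀ n → fromℕ n < fromℕ (suc n)
    x<1+x n = <-respˡ-≈ (+-identityˡ _) (<-respʳ-≈ (sym (1+fromℕ n)) (+-monoˡ-< (fromℕ n) 0<1))

    go : ∀ {n} → suc m ℕ.≤′ n → fromℕ m < fromℕ n
    go ℕ.≤′-refl     = x<1+x m
    go (ℕ.≤′-step {n} p) = <-trans (go p) (x<1+x n)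

  fromℕ-cancel-< : ∀ {m n} → fromℕ m < fromℕ n → m ℕ.< n
  fromℕ-cancel-< {m} {n} p with ℕ.<-cmp m n
  ... | tri< m<n _ _    = m<n
  ... | tri≈ _ ≡.refl _ = contradiction p (<-irrefl refl)
  ... | tri> _ _ n<m    = contradiction p (<-asym (fromℕ-mono n<m))

  fromℕ-injective : ∀ {m n} → fromℕ m ≈ fromℕ n → m ≡ n
  fromℕ-injective {m} {n} p with ℕ.<-cmp m n
  ... | tri< m<n _ _ = contradiction (fromℕ-mono m<n) (<-irrefl p)
  ... | tri≈ _ m≡n _ = m≡n
  ... | tri> _ _ n<m = contradiction (fromℕ-mono n<m) (<-irrefl (sym p))

-- Lipschitz functions on [0,1] as a calculus for continuity.

module LipschitzFunctions (ℝ : RealField) where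
  open OrderedField ℝ

  -- Stands for |x| < B; being strict on both sides it forces B to be positive.
  Within : Carrier → Carrier → Set
  Within B x = - B < x × x < B

  within-pos : ∀ {B x} → Within B x → 0# < B
  within-pos {B} {x} (-B<x , x<B) = double-pos
    (0<-resp (solve 2 (λ B x → (x :- (:- B)) :+ (B :- x) := B :+ B) refl B x)
      (+-pos (0<y-x -B<x) (0<y-x x<B)))

  within-neg : ∀ {B x} → Within B x → Within B (- x)
  within-neg {B} {x} (-B<x , x<B) =
    neg-< x<B , <-respʳ-≈ (solve 1 (λ B → :- (:- B) := B) refl B) (neg-< -B<x)

  -- 2 (B C - x y) = (B - x) (C + y) + (B + x) (C - y)
  within-*-< : ∀ {B C x y} → Within B x → Within C y → x * y < B * C
  within-*-< {B} {C} {x} {y} (-B<x , x<B) (-C<y , y<C) = 0<y-x⇒x<y (double-pos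
    (0<-resp
      (solve 4 (λ B C x y → (B :- x) :* (y :- (:- C)) :+ (x :- (:- B)) :* (C :- y)
                            := (B :* C :- x :* y) :+ (B :* C :- x :* y)) refl B C x y)
      (+-pos (*-pos (0<y-x x<B) (0<y-x -C<y)) (*-pos (0<y-x -B<x) (0<y-x y<C)))))

  within-* : ∀ {B C x y} → Within B x → Within C y → Within (B * C) (x * y)
  within-* {B} {C} {x} {y} p q =
    <-respʳ-≈ (solve 2 (λ x y → :- ((:- x) :* y) := x :* y) refl x y) (neg-< (within-*-< (within-neg p) q)) ,
    within-*-< p q

  within-+ : ∀ {B C x y} → Within B x → Within C y → Within (B + C) (x + y)
  within-+ {B} {C} (p , q) (p′ , q′) =
    <-respˡ-≈ (solve 2 (λ B C → (:- B) :+ (:- C) := :- (B :+ C)) refl B C) (+-mono-< p p′) , +-mono-< q q′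

  bounded : ∀ x → ∃[ B ] Within B x
  bounded x with compare 0# x
  ... | tri< 0<x _ _ = 1# + x ,
    0<y-x⇒x<y (0<-resp (solve 1 (λ x → :1 :+ (x :+ x) := x :- (:- (:1 :+ x))) refl x) (+-pos 0<1 (+-pos 0<x 0<x))) ,
    0<y-x⇒x<y (0<-resp (solve 1 (λ x → :1 := (:1 :+ x) :- x) refl x) 0<1)
  ... | tri≈ _ 0≈x _ = 1# ,
    <-respʳ-≈ 0≈x (0<-x⇒x<0 (0<-resp (solve 0 (:1 := :- (:- :1)) refl) 0<1)) , <-respˡ-≈ 0≈x 0<1
  ... | tri> _ _ x<0 = 1# - x ,
    0<y-x⇒x<y (0<-resp (solve 1 (λ x → :1 := x :- (:- (:1 :- x))) refl x) 0<1) ,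
    0<y-x⇒x<y (0<-resp (solve 1 (λ x → :1 :+ ((:- x) :+ (:- x)) := (:1 :- x) :- x) refl x)
      (+-pos 0<1 (+-pos (x<0⇒0<-x x<0) (x<0⇒0<-x x<0))))

  near⇒within : ∀ {ε x y} → Near ℝ ε x y → Within ε (x - y)
  near⇒within {ε} {x} {y} (p , q) =
    <-respʳ-≈ (solve 2 (λ x y → :- (y :- x) := x :- y) refl x y) (neg-< q) , p

  within⇒near : ∀ {ε x y} → Within ε (x - y) → Near ℝ ε x y
  within⇒near {ε} {x} {y} (p , q) =
    q , <-respʳ-≈ (solve 1 (λ B → :- (:- B) := B) refl ε)
          (<-respˡ-≈ (solve 2 (λ x y → :- (x :- y) := y :- x) refl x y) (neg-< p))

  near-sym : ∀ {ε x y} → Near ℝ ε x y → Near ℝ ε y x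
  near-sym (p , q) = q , p

  within-resp : ∀ {B x y} → x ≈ y → Within B x → Within B y
  within-resp x≈y (p , q) = <-respʳ-≈ x≈y p , <-respˡ-≈ x≈y q

  within-resp-bound : ∀ {B C x} → B ≈ C → Within B x → Within C x
  within-resp-bound B≈C (p , q) = <-respˡ-≈ (-‿cong B≈C) p , <-respʳ-≈ B≈C q

  -- Closed under products with an explicit constant, for which a bound on [0,1] has to be carried
  -- along. `contract` speaks of every `ε` exceeding |s - t|, so that no absolute value is needed.
  record Lipschitz (f : Carrier → Carrier) : Set where
    field
      bound constant : Carrier
      0<constant     : 0# < constant
      within         : ∀ {t} → [0,1] ℝ t → Within bound (f t)
      contract       : ∀ {s t ε} → [0,1] ℝ s → [0,1] ℝ t → 0# < ε →
                       Near ℝ ε s t → Within (constant * ε) (f s - f t)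

  open Lipschitz

  const-lipschitz : ∀ x → Lipschitz (λ _ → x)
  const-lipschitz x = record
    { bound      = proj₁ (bounded x)
    ; constant   = 1#
    ; 0<constant = 0<1
    ; within     = λ _ → proj₂ (bounded x)
    ; contract   = λ {_} {_} {ε} _ _ 0<ε _ →
        <-respʳ-≈ (sym (-‿inverseʳ x)) (0<-x⇒x<0 (0<-resp (solve 1 (λ e → e := :- (:- (:1 :* e))) refl ε) 0<ε)) ,
        <-respʳ-≈ (sym (*-identityˡ ε)) (<-respˡ-≈ (sym (-‿inverseʳ x)) 0<ε)
    }

  id-lipschitz : Lipschitz (λ t → t)
  id-lipschitz = record
    -- `Within` is strict and t = 1 is allowed, so 1 itself would not be a bound.
    { bound      = 1# + 1#
    ; constant   = 1#
    ; 0<constant = 0<1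
    ; within     = λ (0≤t , t≤1) → lower 0≤t , upper t≤1
    ; contract   = λ {_} {_} {ε} _ _ _ near → within-resp-bound (sym (*-identityˡ ε)) (near⇒within near)
    }
    where
    0<2 : 0# < 1# + 1#
    0<2 = +-pos 0<1 0<1

    lower : ∀ {t} → 0# ≤ t → - (1# + 1#) < t
    lower (inj₁ 0<t) = <-trans (0<-x⇒x<0 (0<-resp (solve 0 (:1 :+ :1 := :- (:- (:1 :+ :1))) refl) 0<2)) 0<t
    lower (inj₂ 0≈t) = <-respʳ-≈ 0≈t (0<-x⇒x<0 (0<-resp (solve 0 (:1 :+ :1 := :- (:- (:1 :+ :1))) refl) 0<2))

    upper : ∀ {t} → t ≤ 1# → t < 1# + 1#
    upper t≤1 = 0<y-x⇒x<y (0<-resp (solve 1 (λ t → :1 :+ (:1 :- t) := (:1 :+ :1) :- t) refl _) (go t≤1))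
      where
      go : ∀ {t} → t ≤ 1# → 0# < 1# + (1# - t)
      go (inj₁ t<1) = +-pos 0<1 (0<y-x t<1)
      go (inj₂ t≈1) = 0<-resp (trans (sym (+-identityʳ 1#)) (+-congˡ (sym (x≈y⇒x-y≈0 (sym t≈1))))) 0<1

  +-lipschitz : ∀ {f g} → Lipschitz f → Lipschitz g → Lipschitz (λ t → f t + g t)
  +-lipschitz {f} {g} F G = record
    { bound      = bound F + bound G
    ; constant   = constant F + constant G
    ; 0<constant = +-pos (0<constant F) (0<constant G)
    ; within     = λ t∈ → within-+ (within F t∈) (within G t∈)
    ; contract   = λ {s} {t} {ε} s∈ t∈ 0<ε near →
        within-resp (solve 4 (λ p q r s → (p :- q) :+ (r :- s) := (p :+ r) :- (q :+ s)) refl (f s) (f t) (g s) (g t))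
          (within-resp-bound (sym (distribʳ ε _ _))
            (within-+ (contract F s∈ t∈ 0<ε near) (contract G s∈ t∈ 0<ε near)))
    }

  -- Product rule f s g s - f t g t = f s (g s - g t) + (f s - f t) g t; the factor that is not a
  -- difference is controlled by its bound.
  *-lipschitz : ∀ {f g} → Lipschitz f → Lipschitz g → Lipschitz (λ t → f t * g t)
  *-lipschitz {f} {g} F G = record
    { bound      = bound F * bound G
    ; constant   = bound F * constant G + constant F * bound G
    ; 0<constant = let 0∈ = inj₂ refl , inj₁ 0<1 in
        +-pos (*-pos (within-pos (within F 0∈)) (0<constant G))
              (*-pos (0<constant F) (within-pos (within G 0∈)))
    ; within     = λ t∈ → within-* (within F t∈) (within G t∈)
    ; contract   = λ {s} {t} {ε} s∈ t∈ 0<ε near →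
        within-resp
          (solve 4 (λ p q r s → p :* (r :- s) :+ (p :- q) :* s := p :* r :- q :* s) refl (f s) (f t) (g s) (g t))
          (within-resp-bound
            (solve 5 (λ B K C L e → B :* (L :* e) :+ (K :* e) :* C := (B :* L :+ K :* C) :* e) refl
              (bound F) (constant F) (bound G) (constant G) ε)
            (within-+ (within-* (within F s∈) (contract G s∈ t∈ 0<ε near))
                      (within-* (contract F s∈ t∈ 0<ε near) (within G t∈))))
    }

  neg-lipschitz : ∀ {f} → Lipschitz f → Lipschitz (λ t → - f t)
  neg-lipschitz {f} F = record
    { bound      = bound F
    ; constant   = constant F
    ; 0<constant = 0<constant F
    ; within     = λ t∈ → within-neg (within F t∈)
    ; contract   = λ {s} {t} s∈ t∈ 0<ε near →
        within-resp (solve 2 (λ p q → :- (p :- q) := (:- p) :- (:- q)) refl (f s) (f t))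
          (within-neg (contract F s∈ t∈ 0<ε near))
    }

  infix 9 _⁺
  _⁺ : Carrier → Carrier
  x ⁺ with compare 0# x
  ... | tri< _ _ _ = x
  ... | tri≈ _ _ _ = 0#
  ... | tri> _ _ _ = 0#

  pos⇒⁺≈ : ∀ {x} → 0# < x → x ⁺ ≈ x
  pos⇒⁺≈ {x} 0<x with compare 0# x
  ... | tri< _ _ _   = refl
  ... | tri≈ 0≮x _ _ = contradiction 0<x 0≮x
  ... | tri> 0≮x _ _ = contradiction 0<x 0≮x

  nonpos⇒⁺≈0 : ∀ {x} → ¬ (0# < x) → x ⁺ ≈ 0#
  nonpos⇒⁺≈0 {x} 0≮x with compare 0# x
  ... | tri< 0<x _ _ = contradiction 0<x 0≮x
  ... | tri≈ _ _ _   = refl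
  ... | tri> _ _ _   = refl

  neg-pos : ∀ {B} → 0# < B → - B < 0#
  neg-pos {B} 0<B = 0<-x⇒x<0 (0<-resp (solve 1 (λ B → B := :- (:- B)) refl B) 0<B)

  within-0 : ∀ {B x} → Within B x → Within B 0#
  within-0 p = neg-pos (within-pos p) , within-pos p

  ⁺-within : ∀ {B x} → Within B x → Within B (x ⁺)
  ⁺-within {B} {x} p with compare 0# x
  ... | tri< _ _ _ = p
  ... | tri≈ _ _ _ = within-0 p
  ... | tri> _ _ _ = within-0 p

  -- Taking positive parts does not enlarge a positive difference. One side suffices, since
  -- exchanging x and y gives the other; positivity of B settles the cases with x ≤ 0.
  ⁺-contract-< : ∀ {B} x y → 0# < B → x - y < B → x ⁺ - y ⁺ < B
  ⁺-contract-< {B} x y 0<B p with compare 0# x | compare 0# y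
  ... | tri< _ _ _ | tri< _ _ _   = p
  ... | tri< _ _ _ | tri≈ _ 0≈y _ = <-respˡ-≈ (+-congˡ (-‿cong (sym 0≈y))) p
  ... | tri< _ _ _ | tri> _ _ y<0 = <-trans
    (0<y-x⇒x<y (0<-resp (solve 2 (λ x y → :- y := (x :- y) :- (x :- :0)) refl x y) (x<0⇒0<-x y<0))) p
  ... | tri≈ _ _ _ | tri< 0<y _ _ = <-trans (<-respˡ-≈ (sym (+-identityˡ _)) (neg-pos 0<y)) 0<B
  ... | tri≈ _ _ _ | tri≈ _ _ _   = <-respˡ-≈ (sym (-‿inverseʳ 0#)) 0<B
  ... | tri≈ _ _ _ | tri> _ _ _   = <-respˡ-≈ (sym (-‿inverseʳ 0#)) 0<B
  ... | tri> _ _ _ | tri< 0<y _ _ = <-trans (<-respˡ-≈ (sym (+-identityˡ _)) (neg-pos 0<y)) 0<B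
  ... | tri> _ _ _ | tri≈ _ _ _   = <-respˡ-≈ (sym (-‿inverseʳ 0#)) 0<B
  ... | tri> _ _ _ | tri> _ _ _   = <-respˡ-≈ (sym (-‿inverseʳ 0#)) 0<B

  ⁺-lipschitz : ∀ {f} → Lipschitz f → Lipschitz (λ t → f t ⁺)
  ⁺-lipschitz {f} F = record
    { bound      = bound F
    ; constant   = constant F
    ; 0<constant = 0<constant F
    ; within     = λ t∈ → ⁺-within (within F t∈)
    ; contract   = λ {s} {t} s∈ t∈ 0<ε near → near⇒within
        ( ⁺-contract-< (f s) (f t) (*-pos (0<constant F) 0<ε) (proj₂ (contract F s∈ t∈ 0<ε near))
        , ⁺-contract-< (f t) (f s) (*-pos (0<constant F) 0<ε) (proj₂ (contract F t∈ s∈ 0<ε (near-sym near))))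
    }

  δ-for : ∀ {K ε} → 0# < K → 0# < ε → ∃[ δ ] 0# < δ × K * δ ≈ ε
  δ-for {K} {ε} 0<K 0<ε = let z , Kz≈1 = inverse K (>⇒≉0 0<K) in
    z * ε ,
    *-pos (*-cancelˡ-pos 0<K (0<-resp (sym Kz≈1) 0<1)) 0<ε ,
    trans (sym (*-assoc K z ε)) (trans (*-congʳ Kz≈1) (*-identityˡ ε))

  lipschitz⇒continuous : ∀ {f g} → Lipschitz f → Lipschitz g → ContinuousOn[0,1] ℝ (λ t → f t , g t)
  lipschitz⇒continuous {f} {g} F G s s∈ ε 0<ε =
    -- One δ serves both coordinates: ε is divided by the sum of the two constants, each coordinate
    -- moves by less than its own share, and `enlarge` adds the other share.
    let δ , 0<δ , Kδ≈ε = δ-for (+-pos (0<constant F) (0<constant G)) 0<ε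
        enlarge : ∀ {J K s t} → 0# < K → (J + K) * δ ≈ ε → Within (J * δ) (s - t) → Near ℝ ε s t
        enlarge {J} {K} 0<K e p = within⇒near (within-resp (+-identityʳ _)
          (within-resp-bound (trans (sym (distribʳ δ J K)) e)
            (within-+ p (neg-pos (*-pos 0<K 0<δ) , *-pos 0<K 0<δ))))
    in δ , 0<δ , λ t t∈ near →
      enlarge (0<constant G) Kδ≈ε (contract F s∈ t∈ 0<δ near) ,
      enlarge (0<constant F) (trans (*-congʳ (+-comm _ _)) Kδ≈ε) (contract G s∈ t∈ 0<δ near)

-- Parabolic arcs over intervals with natural end points.

data Page : Set where
  below above : Page

-- An arc runs from the point p, where its edge crosses the axis, to an end q on either side of p;
-- [l, h] is the same interval with its ends sorted. Matching recovers the direction.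
data Span (p q : ℕ) : ℕ → ℕ → Set where
  fwd : p ℕ.< q → Span p q p q
  bwd : q ℕ.< p → Span p q q p

module Parabolas (ℝ : RealField) where
  open OrderedField ℝ

  +-pos-nonneg : ∀ {x y} → 0# < x → 0# ≤ y → 0# < x + y
  +-pos-nonneg 0<x (inj₁ 0<y) = +-pos 0<x 0<y
  +-pos-nonneg {x} 0<x (inj₂ 0≈y) = 0<-resp (trans (sym (+-identityʳ x)) (+-congˡ 0≈y)) 0<x

  *-pos-nonneg : ∀ {x y} → 0# < x → 0# ≤ y → 0# ≤ x * y
  *-pos-nonneg 0<x (inj₁ 0<y) = inj₁ (*-pos 0<x 0<y)
  *-pos-nonneg {x} 0<x (inj₂ 0≈y) = inj₂ (trans (sym (zeroʳ x)) (*-congˡ 0≈y))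

  square-pos : ∀ {x} → ¬ (x ≈ 0#) → 0# < x * x
  square-pos {x} x≉0 with compare 0# x
  ... | tri< 0<x _ _ = *-pos 0<x 0<x
  ... | tri≈ _ 0≈x _ = contradiction (sym 0≈x) x≉0
  ... | tri> _ _ x<0 = 0<-resp (solve 1 (λ x → (:- x) :* (:- x) := x :* x) refl x)
    (*-pos (x<0⇒0<-x x<0) (x<0⇒0<-x x<0))

  signed : Page → Carrier → Carrier
  signed above y = y
  signed below y = - y

  signed-cong : ∀ p {x y} → x ≈ y → signed p x ≈ signed p y
  signed-cong above x≈y = x≈y
  signed-cong below x≈y = -‿cong x≈y

  signed-injective : ∀ p {x y} → signed p x ≈ signed p y → x ≈ y
  signed-injective above x≈y = x≈y
  signed-injective below {x} {y} x≈y =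
    trans (solve 1 (λ x → x := :- (:- x)) refl x) (trans (-‿cong x≈y) (solve 1 (λ x → :- (:- x) := x) refl y))

  signed≉0 : ∀ p {y} → 0# < y → ¬ (signed p y ≈ 0#)
  signed≉0 above 0<y e = ≈0⇒≯0 e 0<y
  signed≉0 below {y} 0<y e =
    ≈0⇒≯0 (trans (solve 1 (λ x → x := :- (:- x)) refl y) (trans (-‿cong e) (solve 0 (:- :0 := :0) refl))) 0<y

  signed-page : ∀ p q {x y} → 0# < x → 0# < y → signed p x ≈ signed q y → p ≡ q
  signed-page above above _ _ _ = ≡.refl
  signed-page below below _ _ _ = ≡.refl
  signed-page above below {x} {y} 0<x 0<y e =
    contradiction (+-pos 0<x 0<y) (≈0⇒≯0 (trans (+-congʳ e) (-‿inverseˡ y)))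
  signed-page below above {x} {y} 0<x 0<y e =
    contradiction (+-pos 0<x 0<y) (≈0⇒≯0 (trans (+-congˡ (sym e)) (-‿inverseʳ x)))

  hump : Carrier → Carrier → Carrier → Carrier
  hump l h x = (x - l) * (h - x)

  hump-cong : ∀ l h {x y} → x ≈ y → hump l h x ≈ hump l h y
  hump-cong l h e = *-cong (+-congʳ e) (+-congˡ (-‿cong e))

  Inside : ℕ → ℕ → Carrier → Set
  Inside l h x = fromℕ l < x × x < fromℕ h

  hump-pos : ∀ l h {x} → Inside l h x → 0# < hump (fromℕ l) (fromℕ h) x
  hump-pos l h (l<x , x<h) = *-pos (0<y-x l<x) (0<y-x x<h)

  inside-resp : ∀ {l h x y} → x ≈ y → Inside l h x → Inside l h y
  inside-resp x≈y (p , q) = <-respʳ-≈ x≈y p , <-respˡ-≈ x≈y q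

  along : ℕ → ℕ → Carrier → Carrier
  along p q v = fromℕ p + v * (fromℕ q - fromℕ p)

  span-≢ : ∀ {p q l h} → Span p q l h → ¬ (fromℕ q - fromℕ p ≈ 0#)
  span-≢ (fwd p<q) e = >⇒≉0 (0<y-x (fromℕ-mono p<q)) e
  span-≢ (bwd q<p) e = <-irrefl (x-y≈0⇒x≈y e) (fromℕ-mono q<p)

  along-inside : ∀ {p q l h} → Span p q l h → ∀ {v} → 0# < v → v < 1# → Inside l h (along p q v)
  along-inside {p} {q} (fwd p<q) {v} 0<v v<1 =
    0<y-x⇒x<y (0<-resp (solve 3 (λ P Q v → v :* (Q :- P) := (P :+ v :* (Q :- P)) :- P) refl (fromℕ p) (fromℕ q) v)
      (*-pos 0<v (0<y-x (fromℕ-mono p<q)))) ,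
    0<y-x⇒x<y (0<-resp (solve 3 (λ P Q v → (:1 :- v) :* (Q :- P) := Q :- (P :+ v :* (Q :- P))) refl (fromℕ p) (fromℕ q) v)
      (*-pos (0<y-x v<1) (0<y-x (fromℕ-mono p<q))))
  along-inside {p} {q} (bwd q<p) {v} 0<v v<1 =
    0<y-x⇒x<y (0<-resp (solve 3 (λ P Q v → (:1 :- v) :* (P :- Q) := (P :+ v :* (Q :- P)) :- Q) refl (fromℕ p) (fromℕ q) v)
      (*-pos (0<y-x v<1) (0<y-x (fromℕ-mono q<p)))) ,
    0<y-x⇒x<y (0<-resp (solve 3 (λ P Q v → v :* (P :- Q) := P :- (P :+ v :* (Q :- P))) refl (fromℕ p) (fromℕ q) v)
      (*-pos 0<v (0<y-x (fromℕ-mono q<p))))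

  -- In the parameter v the parabola is (q - p)² v (1 - v), whichever way the interval is traversed.
  -- This is why the ordinate of an arc contains the square of its reach.
  along-hump : ∀ {p q l h} → Span p q l h → ∀ v →
               ((fromℕ q - fromℕ p) * (fromℕ q - fromℕ p)) * (v * (1# - v)) ≈ hump (fromℕ l) (fromℕ h) (along p q v)
  along-hump {p} {q} (fwd _) v = solve 3 (λ P Q v → ((Q :- P) :* (Q :- P)) :* (v :* (:1 :- v))
    := ((P :+ v :* (Q :- P)) :- P) :* (Q :- (P :+ v :* (Q :- P)))) refl (fromℕ p) (fromℕ q) v
  along-hump {p} {q} (bwd _) v = solve 3 (λ P Q v → ((Q :- P) :* (Q :- P)) :* (v :* (:1 :- v))
    := ((P :+ v :* (Q :- P)) :- Q) :* (P :- (P :+ v :* (Q :- P)))) refl (fromℕ p) (fromℕ q) v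

  -- Take v = (x - p) / d with d = q - p; the signs of v and 1 - v are read off d v = x - p and d (1
  -- - v) = q - x.
  along-onto : ∀ {p q l h} → Span p q l h → ∀ {x} → Inside l h x → ∃[ v ] 0# < v × v < 1# × along p q v ≈ x
  along-onto {p} {q} span {x} inside =
    let z , dz≈1 = inverse d (span-≢ span)
        v = z * (x - P)
        dv≈ : d * v ≈ x - P
        dv≈ = trans (sym (*-assoc d z _)) (trans (*-congʳ dz≈1) (*-identityˡ _))
        d[1-v]≈ : d * (1# - v) ≈ Q - x
        d[1-v]≈ = trans (solve 3 (λ P Q v → (Q :- P) :* (:1 :- v) := (Q :- P) :- (Q :- P) :* v) refl P Q v)
          (trans (+-congˡ (-‿cong dv≈)) (solve 3 (λ P Q x → (Q :- P) :- (x :- P) := Q :- x) refl P Q x))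
        0<v , 0<1-v = positive span inside dv≈ d[1-v]≈
    in v , 0<v , 0<y-x⇒x<y 0<1-v ,
       trans (+-congˡ (trans (*-comm v d) dv≈)) (solve 2 (λ P x → P :+ (x :- P) := x) refl P x)
    where
    P = fromℕ p
    Q = fromℕ q
    d = Q - P

    negated : ∀ {v P Q x y} → (Q - P) * v ≈ x - y → x < y → Q < P → 0# < v
    negated {v} {P} {Q} {x} {y} e x<y Q<P = *-cancelˡ-pos (0<y-x Q<P)
      (0<-resp (trans (solve 2 (λ x y → y :- x := :- (x :- y)) refl x y)
        (trans (-‿cong (sym e)) (solve 3 (λ v P Q → :- ((Q :- P) :* v) := (P :- Q) :* v) refl v P Q)))
        (0<y-x x<y))

    positive : ∀ {l h v} → Span p q l h → Inside l h x → d * v ≈ x - P → d * (1# - v) ≈ Q - x →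
               0# < v × 0# < 1# - v
    positive (fwd p<q) (P<x , x<Q) e e′ =
      *-cancelˡ-pos (0<y-x (fromℕ-mono p<q)) (0<-resp (sym e) (0<y-x P<x)) ,
      *-cancelˡ-pos (0<y-x (fromℕ-mono p<q)) (0<-resp (sym e′) (0<y-x x<Q))
    positive (bwd q<p) (Q<x , x<P) e e′ =
      negated e x<P (fromℕ-mono q<p) , negated e′ Q<x (fromℕ-mono q<p)

  -- (x - l) (h - x) - (x - l′) (h′ - x) = (l′ - l) (h - x) + (x - l′) (h - h′)
  hump-nested : ∀ {l h l′ h′ x} → l < x × x < h → l′ < x × x < h′ → l ≤ l′ → h′ ≤ h → l < l′ ⊎ h′ < h →
                ¬ (hump l h x ≈ hump l′ h′ x)
  hump-nested {l} {h} {l′} {h′} {x} (l<x , x<h) (l′<x , x<h′) l≤l′ h′≤h strict e =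
    ≈0⇒≯0 (x≈y⇒x-y≈0 e)
      (0<-resp (solve 5 (λ l h l′ h′ x → (h :- x) :* (l′ :- l) :+ (x :- l′) :* (h :- h′)
                                        := (x :- l) :* (h :- x) :- (x :- l′) :* (h′ :- x)) refl l h l′ h′ x)
        (go strict))
    where
    nonneg : ∀ {x y} → x ≤ y → 0# ≤ y - x
    nonneg (inj₁ x<y) = inj₁ (0<y-x x<y)
    nonneg (inj₂ x≈y) = inj₂ (sym (x≈y⇒x-y≈0 (sym x≈y)))

    go : l < l′ ⊎ h′ < h → 0# < (h - x) * (l′ - l) + (x - l′) * (h - h′)
    go (inj₁ l<l′) = +-pos-nonneg (*-pos (0<y-x x<h) (0<y-x l<l′)) (*-pos-nonneg (0<y-x l′<x) (nonneg h′≤h))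
    go (inj₂ h′<h) = 0<-resp (+-comm _ _)
      (+-pos-nonneg (*-pos (0<y-x l′<x) (0<y-x h′<h)) (*-pos-nonneg (0<y-x x<h) (nonneg l≤l′)))

  Meet : ℕ → ℕ → ℕ → ℕ → Carrier → Set
  Meet l h l′ h′ x = hump (fromℕ l) (fromℕ h) x ≈ hump (fromℕ l′) (fromℕ h′) x

  -- If one interval properly contains the other, even with a common end, its parabola is strictly
  -- higher inside the smaller one, by `hump-nested`. Only shifted or equal intervals remain.
  meet⇒interleave : ∀ l h l′ h′ {x} → Inside l h x → Inside l′ h′ x → Meet l h l′ h′ x →
                    (l ℕ.< l′ × h ℕ.< h′) ⊎ (l′ ℕ.< l × h′ ℕ.< h) ⊎ (l ≡ l′ × h ≡ h′)
  meet⇒interleave l h l′ h′ p p′ e with ℕ.<-cmp l l′ | ℕ.<-cmp h h′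
  ... | tri< l<l′ _ _    | tri< h<h′ _ _    = inj₁ (l<l′ , h<h′)
  ... | tri> _ _ l′<l    | tri> _ _ h′<h    = inj₂ (inj₁ (l′<l , h′<h))
  ... | tri≈ _ l≡l′ _    | tri≈ _ h≡h′ _    = inj₂ (inj₂ (l≡l′ , h≡h′))
  ... | tri< l<l′ _ _    | tri≈ _ ≡.refl _  = contradiction e
    (hump-nested p p′ (inj₁ (fromℕ-mono l<l′)) (inj₂ refl) (inj₁ (fromℕ-mono l<l′)))
  ... | tri< l<l′ _ _    | tri> _ _ h′<h    = contradiction e
    (hump-nested p p′ (inj₁ (fromℕ-mono l<l′)) (inj₁ (fromℕ-mono h′<h)) (inj₁ (fromℕ-mono l<l′)))
  ... | tri≈ _ ≡.refl _  | tri> _ _ h′<h    = contradiction e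
    (hump-nested p p′ (inj₂ refl) (inj₁ (fromℕ-mono h′<h)) (inj₂ (fromℕ-mono h′<h)))
  ... | tri≈ _ ≡.refl _  | tri< h<h′ _ _    = contradiction (sym e)
    (hump-nested p′ p (inj₂ refl) (inj₁ (fromℕ-mono h<h′)) (inj₂ (fromℕ-mono h<h′)))
  ... | tri> _ _ l′<l    | tri≈ _ ≡.refl _  = contradiction (sym e)
    (hump-nested p′ p (inj₁ (fromℕ-mono l′<l)) (inj₂ refl) (inj₁ (fromℕ-mono l′<l)))
  ... | tri> _ _ l′<l    | tri< h<h′ _ _    = contradiction (sym e)
    (hump-nested p′ p (inj₁ (fromℕ-mono l′<l)) (inj₁ (fromℕ-mono h<h′)) (inj₁ (fromℕ-mono l′<l)))

  -- The quadratic terms cancel, so the two parabolas meet on one vertical line.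
  meet-linear : ∀ l h l′ h′ {x} → Meet l h l′ h′ x →
                ((fromℕ l′ + fromℕ h′) - (fromℕ l + fromℕ h)) * x ≈ fromℕ l′ * fromℕ h′ - fromℕ l * fromℕ h
  meet-linear l h l′ h′ {x} e = x-y≈0⇒x≈y
    (trans (solve 5 (λ l h l′ h′ x → ((l′ :+ h′) :- (l :+ h)) :* x :- (l′ :* h′ :- l :* h)
                                    := (x :- l′) :* (h′ :- x) :- (x :- l) :* (h :- x)) refl
             (fromℕ l) (fromℕ h) (fromℕ l′) (fromℕ h′) x)
      (x≈y⇒x-y≈0 (sym e)))

  module _ {l h l′ h′ : ℕ} (l<l′ : l ℕ.< l′) (h<h′ : h ℕ.< h′) where
    private
      L  = fromℕ l
      H  = fromℕ h
      L′ = fromℕ l′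
      H′ = fromℕ h′

      slope numerator : Carrier
      slope     = (L′ + H′) - (L + H)
      numerator = L′ * H′ - L * H

      0<slope : 0# < slope
      0<slope = 0<y-x (+-mono-< (fromℕ-mono l<l′) (fromℕ-mono h<h′))

    meet-unique : ∀ {x y} → Meet l h l′ h′ x → Meet l h l′ h′ y → x ≈ y
    meet-unique p q =
      *-cancelˡ (>⇒≉0 0<slope) (trans (meet-linear l h l′ h′ p) (sym (meet-linear l h l′ h′ q)))

    -- With x = `numerator` / `slope`, the identities slope (x - l′) = (l′ - l) (h - l′) and slope
    -- (h - x) = (h′ - h) (h - l′) place x in the common part of the two intervals.
    meet-exists : l′ ℕ.< h → ∃[ x ] Inside l′ h x × Meet l h l′ h′ x
    meet-exists l′<h = x , (0<y-x⇒x<y (*-cancelˡ-pos 0<slope below-x) , 0<y-x⇒x<y (*-cancelˡ-pos 0<slope above-x)) , meets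
      where
      z = proj₁ (inverse slope (>⇒≉0 0<slope))
      x = z * numerator

      slope*x : slope * x ≈ numerator
      slope*x = trans (sym (*-assoc slope z numerator))
        (trans (*-congʳ (proj₂ (inverse slope (>⇒≉0 0<slope)))) (*-identityˡ numerator))

      below-x : 0# < slope * (x - L′)
      below-x = 0<-resp
        (trans (solve 4 (λ l h l′ h′ → (l′ :- l) :* (h :- l′) := (l′ :* h′ :- l :* h) :- ((l′ :+ h′) :- (l :+ h)) :* l′)
                 refl L H L′ H′)
          (trans (+-congʳ (sym slope*x)) (solve 3 (λ s x l → s :* x :- s :* l := s :* (x :- l)) refl slope x L′)))
        (*-pos (0<y-x (fromℕ-mono l<l′)) (0<y-x (fromℕ-mono l′<h)))

      above-x : 0# < slope * (H - x)
      above-x = 0<-resp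
        (trans (solve 4 (λ l h l′ h′ → (h′ :- h) :* (h :- l′) := ((l′ :+ h′) :- (l :+ h)) :* h :- (l′ :* h′ :- l :* h))
                 refl L H L′ H′)
          (trans (+-congˡ (-‿cong (sym slope*x))) (solve 3 (λ s x l → s :* l :- s :* x := s :* (l :- x)) refl slope x H)))
        (*-pos (0<y-x (fromℕ-mono h<h′)) (0<y-x (fromℕ-mono l′<h)))

      meets : Meet l h l′ h′ x
      meets = sym (x-y≈0⇒x≈y (trans
        (solve 5 (λ l h l′ h′ x → (x :- l′) :* (h′ :- x) :- (x :- l) :* (h :- x)
                                 := ((l′ :+ h′) :- (l :+ h)) :* x :- (l′ :* h′ :- l :* h)) refl L H L′ H′ x)
        (x≈y⇒x-y≈0 slope*x)))

-- The arc of an edge: two parabolas glued at a point of the axis.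

module Arcs (ℝ : RealField) where
  open OrderedField ℝ
  open LipschitzFunctions ℝ
  open Parabolas ℝ

  ⁺-cong : ∀ {x y} → x ≈ y → x ⁺ ≈ y ⁺
  ⁺-cong {x} {y} e with compare 0# x
  ... | tri< 0<x _ _ = trans e (sym (pos⇒⁺≈ (0<-resp e 0<x)))
  ... | tri≈ 0≮x _ _ = sym (nonpos⇒⁺≈0 (λ 0<y → 0≮x (0<-resp (sym e) 0<y)))
  ... | tri> 0≮x _ _ = sym (nonpos⇒⁺≈0 (λ 0<y → 0≮x (0<-resp (sym e) 0<y)))

  pos⇒neg⁺≈0 : ∀ {w} → 0# < w → (- w) ⁺ ≈ 0#
  pos⇒neg⁺≈0 0<w = nonpos⇒⁺≈0 (λ 0<-w → <-asym 0<w (0<-x⇒x<0 0<-w))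

  -- The time t ∈ [0,1] is replaced by w ∈ [-1,1]; the arc runs below the axis for
  -- w < 0 and above it for w > 0, starting below or above as the flag says.
  param : Bool → Carrier → Carrier
  param true  t = (t + t) - 1#
  param false t = 1# - (t + t)

  param-lipschitz : ∀ s → Lipschitz (param s)
  param-lipschitz true  = +-lipschitz (+-lipschitz id-lipschitz id-lipschitz) (const-lipschitz (- 1#))
  param-lipschitz false = +-lipschitz (const-lipschitz 1#) (neg-lipschitz (+-lipschitz id-lipschitz id-lipschitz))

  double-cancel : ∀ {x y} → x + x ≈ y + y → x ≈ y
  double-cancel {x} {y} e = *-cancelˡ (>⇒≉0 (+-pos 0<1 0<1))
    (trans (solve 1 (λ x → (:1 :+ :1) :* x := x :+ x) refl x)
      (trans e (solve 1 (λ x → x :+ x := (:1 :+ :1) :* x) refl y)))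

  param-injective : ∀ s {t u} → param s t ≈ param s u → t ≈ u
  param-injective true {t} {u} e = double-cancel
    (trans (solve 1 (λ t → t := (t :- :1) :+ :1) refl (t + t))
      (trans (+-congʳ e) (solve 1 (λ t → (t :- :1) :+ :1 := t) refl (u + u))))
  param-injective false {t} {u} e = double-cancel
    (trans (solve 1 (λ t → t := :1 :- (:1 :- t)) refl (t + t))
      (trans (+-congˡ (-‿cong e)) (solve 1 (λ t → :1 :- (:1 :- t) := t) refl (u + u))))

  ]-1,1[ : Carrier → Set
  ]-1,1[ w = - 1# < w × w < 1#

  [-1,1] : Carrier → Set
  [-1,1] w = - 1# ≤ w × w ≤ 1#

  param-open : ∀ s {t} → ]0,1[ ℝ t → ]-1,1[ (param s t)
  param-open s {t} (0<t , t<1) = lo s , hi s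
    where
    2t>0 : 0# < t + t
    2t>0 = +-pos 0<t 0<t
    2t<2 : 0# < (1# - t) + (1# - t)
    2t<2 = +-pos (0<y-x t<1) (0<y-x t<1)
    lo : ∀ s → - 1# < param s t
    lo true  = 0<y-x⇒x<y (0<-resp (solve 1 (λ t → t :+ t := ((t :+ t) :- :1) :- (:- :1)) refl t) 2t>0)
    lo false = 0<y-x⇒x<y (0<-resp (solve 1 (λ t → (:1 :- t) :+ (:1 :- t) := (:1 :- (t :+ t)) :- (:- :1)) refl t) 2t<2)
    hi : ∀ s → param s t < 1#
    hi true  = 0<y-x⇒x<y (0<-resp (solve 1 (λ t → (:1 :- t) :+ (:1 :- t) := :1 :- ((t :+ t) :- :1)) refl t) 2t<2)
    hi false = 0<y-x⇒x<y (0<-resp (solve 1 (λ t → t :+ t := :1 :- (:1 :- (t :+ t))) refl t) 2t>0)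

  param-cong : ∀ s {t u} → t ≈ u → param s t ≈ param s u
  param-cong true  e = +-congʳ (+-cong e e)
  param-cong false e = +-congˡ (-‿cong (+-cong e e))

  start finish : Bool → Carrier
  start true   = - 1#
  start false  = 1#
  finish true  = 1#
  finish false = - 1#

  param-start : ∀ s → param s 0# ≈ start s
  param-start true  = solve 0 ((:0 :+ :0) :- :1 := :- :1) refl
  param-start false = solve 0 (:1 :- (:0 :+ :0) := :1) refl

  param-finish : ∀ s → param s 1# ≈ finish s
  param-finish true  = solve 0 ((:1 :+ :1) :- :1 := :1) refl
  param-finish false = solve 0 (:1 :- (:1 :+ :1) := :- :1) refl

  -1<1 : - 1# < 1#
  -1<1 = <-trans (neg-pos 0<1) 0<1

  start∈ : ∀ s → [-1,1] (start s)
  start∈ true  = inj₂ refl , inj₁ -1<1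
  start∈ false = inj₁ -1<1 , inj₂ refl

  finish∈ : ∀ s → [-1,1] (finish s)
  finish∈ true  = inj₁ -1<1 , inj₂ refl
  finish∈ false = inj₂ refl , inj₁ -1<1

  []-resp : ∀ {x y} → x ≈ y → [-1,1] x → [-1,1] y
  []-resp {x} {y} e (p , q) = lower p , upper q
    where
    lower : - 1# ≤ x → - 1# ≤ y
    lower (inj₁ p) = inj₁ (<-respʳ-≈ e p)
    lower (inj₂ p) = inj₂ (trans p e)
    upper : x ≤ 1# → y ≤ 1#
    upper (inj₁ p) = inj₁ (<-respˡ-≈ e p)
    upper (inj₂ p) = inj₂ (trans (sym e) p)

  param-closed : ∀ s {t} → [0,1] ℝ t → [-1,1] (param s t)
  param-closed s (inj₁ 0<t , inj₁ t<1) = let p , q = param-open s (0<t , t<1) in inj₁ p , inj₁ q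
  param-closed s (inj₂ 0≈t , _) = []-resp (trans (sym (param-start s)) (param-cong s 0≈t)) (start∈ s)
  param-closed s (_ , inj₂ t≈1) = []-resp (trans (sym (param-finish s)) (param-cong s (sym t≈1))) (finish∈ s)

  param-onto : ∀ s {w} → ]-1,1[ w → ∃[ t ] ]0,1[ ℝ t × param s t ≈ w
  param-onto s {w} (-1<w , w<1) = t s , (double-pos (low s) , 0<y-x⇒x<y (double-pos (high s))) , onto s
    where
    ½ : Carrier
    ½ = proj₁ (inverse (1# + 1#) (>⇒≉0 (+-pos 0<1 0<1)))

    halve : ∀ x → ½ * x + ½ * x ≈ x
    halve x = trans (solve 2 (λ h x → h :* x :+ h :* x := ((:1 :+ :1) :* h) :* x) refl ½ x)
      (trans (*-congʳ (proj₂ (inverse (1# + 1#) (>⇒≉0 (+-pos 0<1 0<1))))) (*-identityˡ x))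

    t : Bool → Carrier
    t true  = ½ * (w - - 1#)
    t false = ½ * (1# - w)

    low : ∀ s → 0# < t s + t s
    low true  = 0<-resp (sym (halve _)) (0<y-x -1<w)
    low false = 0<-resp (sym (halve _)) (0<y-x w<1)

    high : ∀ s → 0# < (1# - t s) + (1# - t s)
    high true  = 0<-resp (trans (solve 1 (λ w → :1 :- w := (:1 :+ :1) :- (w :- (:- :1))) refl w)
      (trans (+-congˡ (-‿cong (sym (halve _)))) (solve 1 (λ t → (:1 :+ :1) :- (t :+ t) := (:1 :- t) :+ (:1 :- t)) refl (t true))))
      (0<y-x w<1)
    high false = 0<-resp (trans (solve 1 (λ w → w :- (:- :1) := (:1 :+ :1) :- (:1 :- w)) refl w)
      (trans (+-congˡ (-‿cong (sym (halve _)))) (solve 1 (λ t → (:1 :+ :1) :- (t :+ t) := (:1 :- t) :+ (:1 :- t)) refl (t false))))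
      (0<y-x -1<w)

    onto : ∀ s → param s (t s) ≈ w
    onto true  = trans (+-congʳ (halve _)) (solve 1 (λ w → (w :- (:- :1)) :- :1 := w) refl w)
    onto false = trans (+-congˡ (-‿cong (halve _))) (solve 1 (λ w → :1 :- (:1 :- w) := w) refl w)

  -- `c` is where the edge crosses the axis, `foot p` the end that it reaches on page `p`. The
  -- positive parts of w and -w merge both pieces into one formula, so that continuity follows from
  -- the Lipschitz calculus without gluing.
  module Arc (c : ℕ) (foot : Page → ℕ) where

    reach : Page → Carrier
    reach p = fromℕ (foot p) - fromℕ c

    abstract
      abscissa ordinate : Carrier → Carrier
      abscissa w = fromℕ c + (w ⁺ * reach above + (- w) ⁺ * reach below)
      ordinate w = (reach above * reach above) * (w ⁺ * (1# - w ⁺))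
                 - (reach below * reach below) * ((- w) ⁺ * (1# - (- w) ⁺))

    place : Carrier → Plane ℝ
    place w = abscissa w , ordinate w

    -- The parameter w with |w| = v whose point lies on the given page.
    onward : Page → Carrier → Carrier
    onward above w = w
    onward below w = - w

    abstract
      abscissa-lipschitz : ∀ {f} → Lipschitz f → Lipschitz (λ t → abscissa (f t))
      abscissa-lipschitz F = +-lipschitz (const-lipschitz _) (+-lipschitz
        (*-lipschitz (⁺-lipschitz F) (const-lipschitz _))
        (*-lipschitz (⁺-lipschitz (neg-lipschitz F)) (const-lipschitz _)))

      ordinate-lipschitz : ∀ {f} → Lipschitz f → Lipschitz (λ t → ordinate (f t))
      ordinate-lipschitz F = +-lipschitz
        (*-lipschitz (const-lipschitz _) (v[1-v]-lipschitz (⁺-lipschitz F)))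
        (neg-lipschitz (*-lipschitz (const-lipschitz _) (v[1-v]-lipschitz (⁺-lipschitz (neg-lipschitz F)))))
        where
        v[1-v]-lipschitz : ∀ {f} → Lipschitz f → Lipschitz (λ t → f t * (1# - f t))
        v[1-v]-lipschitz F = *-lipschitz F (+-lipschitz (const-lipschitz 1#) (neg-lipschitz F))

      place-cong : ∀ {w u} → w ≈ u → _≋_ ℝ (place w) (place u)
      place-cong {w} {u} e =
        +-congˡ (+-cong (*-congʳ e⁺) (*-congʳ e⁻)) ,
        +-cong (*-congˡ (*-cong e⁺ (+-congˡ (-‿cong e⁺))))
               (-‿cong (*-congˡ (*-cong e⁻ (+-congˡ (-‿cong e⁻)))))
        where
        e⁺ : w ⁺ ≈ u ⁺
        e⁺ = ⁺-cong e
        e⁻ : (- w) ⁺ ≈ (- u) ⁺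
        e⁻ = ⁺-cong (-‿cong e)

      place-page : ∀ p {v} → 0# < v → _≋_ ℝ (place (onward p v))
        (along c (foot p) v , signed p ((reach p * reach p) * (v * (1# - v))))
      place-page above {v} 0<v =
        trans (+-congˡ (+-cong (*-congʳ (pos⇒⁺≈ 0<v)) (*-congʳ (pos⇒neg⁺≈0 0<v))))
          (solve 4 (λ c v a b → c :+ (v :* a :+ :0 :* b) := c :+ v :* a) refl (fromℕ c) v (reach above) (reach below)) ,
        trans (+-cong (*-congˡ (*-cong (pos⇒⁺≈ 0<v) (+-congˡ (-‿cong (pos⇒⁺≈ 0<v)))))
                      (-‿cong (*-congˡ (*-congʳ (pos⇒neg⁺≈0 0<v)))))
          (solve 4 (λ v a b u → a :* (v :* (:1 :- v)) :- b :* (:0 :* u) := a :* (v :* (:1 :- v))) refl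
            v (reach above * reach above) (reach below * reach below) _)
      place-page below {v} 0<v =
        trans (+-congˡ (+-cong (*-congʳ (pos⇒neg⁺≈0 0<v)) (*-congʳ neg)))
          (solve 4 (λ c v a b → c :+ (:0 :* a :+ v :* b) := c :+ v :* b) refl (fromℕ c) v (reach above) (reach below)) ,
        trans (+-cong (*-congˡ (*-congʳ (pos⇒neg⁺≈0 0<v)))
                      (-‿cong (*-congˡ (*-cong neg (+-congˡ (-‿cong neg))))))
          (solve 4 (λ v a b u → a :* (:0 :* u) :- b :* (v :* (:1 :- v)) := :- (b :* (v :* (:1 :- v)))) refl
            v (reach above * reach above) (reach below * reach below) _)
        where
        neg : (- - v) ⁺ ≈ v
        neg = trans (⁺-cong (solve 1 (λ v → :- (:- v) := v) refl v)) (pos⇒⁺≈ 0<v)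

      place-0 : ∀ {w} → w ≈ 0# → _≋_ ℝ (place w) (fromℕ c , 0#)
      place-0 {w} e =
        trans (+-congˡ (+-cong (*-congʳ e⁺) (*-congʳ e⁻)))
          (solve 3 (λ c a b → c :+ (:0 :* a :+ :0 :* b) := c) refl (fromℕ c) (reach above) (reach below)) ,
        trans (+-cong (*-congˡ (*-congʳ e⁺)) (-‿cong (*-congˡ (*-congʳ e⁻))))
          (solve 4 (λ a b u v → a :* (:0 :* u) :- b :* (:0 :* v) := :0) refl
            (reach above * reach above) (reach below * reach below) _ _)
        where
        e⁺ : w ⁺ ≈ 0#
        e⁺ = nonpos⇒⁺≈0 (≈0⇒≯0 e)
        e⁻ : (- w) ⁺ ≈ 0#
        e⁻ = nonpos⇒⁺≈0 (≈0⇒≯0 (trans (-‿cong e) (solve 0 (:- :0 := :0) refl)))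

    place-foot : ∀ p → _≋_ ℝ (place (onward p 1#)) (fromℕ (foot p) , 0#)
    place-foot p = let x , y = place-page p 0<1 in
      trans x (solve 2 (λ c f → c :+ :1 :* (f :- c) := f) refl (fromℕ c) (fromℕ (foot p))) ,
      trans y (trans (signed-cong p (solve 1 (λ a → a :* (:1 :* (:1 :- :1)) := :0) refl (reach p * reach p))) (signed-0 p))
      where
      signed-0 : ∀ p → signed p 0# ≈ 0#
      signed-0 above = refl
      signed-0 below = solve 0 (:- :0 := :0) refl

    data Side (w : Carrier) : Set where
      mid  : w ≈ 0# → Side w
      page : ∀ p v → 0# < v → w ≈ onward p v → Side w

    side : ∀ w → Side w
    side w with compare 0# w
    ... | tri< 0<w _ _ = page above w 0<w refl
    ... | tri≈ _ 0≈w _ = mid (sym 0≈w)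
    ... | tri> _ _ w<0 = page below (- w) (x<0⇒0<-x w<0) (solve 1 (λ w → w := :- (:- w)) refl w)

    module Spanned (lo hi : Page → ℕ) (span : ∀ p → Span c (foot p) (lo p) (hi p)) where

      On : Page → Plane ℝ → Set
      On p (x , y) = Inside (lo p) (hi p) x × y ≈ signed p (hump (fromℕ (lo p)) (fromℕ (hi p)) x)

      on-resp : ∀ p {z z′} → _≋_ ℝ z z′ → On p z → On p z′
      on-resp p (x≈x′ , y≈y′) (inside , e) =
        inside-resp {lo p} {hi p} x≈x′ inside , trans (sym y≈y′) (trans e (signed-cong p (hump-cong _ _ x≈x′)))

      onward<1⇒<1 : ∀ p {v w} → w ≈ onward p v → ]-1,1[ w → v < 1#
      onward<1⇒<1 above e (_ , w<1) = <-respˡ-≈ e w<1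
      onward<1⇒<1 below {v} e (-1<w , _) = 0<y-x⇒x<y
        (0<-resp (trans (+-congʳ e) (solve 1 (λ v → (:- v) :- (:- :1) := :1 :- v) refl v)) (0<y-x -1<w))

      page⇒on : ∀ p {v w} → 0# < v → w ≈ onward p v → ]-1,1[ w → On p (place w)
      page⇒on p {v} {w} 0<v e w∈ =
        on-resp p (sym (proj₁ w≋) , sym (proj₂ w≋))
          (along-inside (span p) 0<v (onward<1⇒<1 p e w∈) , signed-cong p (along-hump (span p) v))
        where
        w≋ : _≋_ ℝ (place w) (along c (foot p) v , signed p ((reach p * reach p) * (v * (1# - v))))
        w≋ = trans (proj₁ (place-cong e)) (proj₁ (place-page p 0<v)) ,
             trans (proj₂ (place-cong e)) (proj₂ (place-page p 0<v))

      data Location (w : Carrier) : Set where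
        at-mid  : w ≈ 0# → Location w
        on-page : ∀ p → On p (place w) → Location w

      location : ∀ {w} → ]-1,1[ w → Location w
      location {w} w∈ with side w
      ... | mid w≈0        = at-mid w≈0
      ... | page p v 0<v e = on-page p (page⇒on p 0<v e w∈)

      onto-page : ∀ p {x} → Inside (lo p) (hi p) x →
                  ∃[ w ] ]-1,1[ w × _≋_ ℝ (place w) (x , signed p (hump (fromℕ (lo p)) (fromℕ (hi p)) x))
      onto-page p {x} inside =
        let v , 0<v , v<1 , e = along-onto (span p) inside
            X , Y = place-page p 0<v
        in onward p v , range p 0<v v<1 , trans X e ,
           trans Y (signed-cong p (trans (along-hump (span p) v) (hump-cong _ _ e)))
        where
        range : ∀ p {v} → 0# < v → v < 1# → ]-1,1[ (onward p v)
        range above 0<v v<1 = <-trans (neg-pos 0<1) 0<v , v<1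
        range below 0<v v<1 = neg-< v<1 , <-trans (neg-pos 0<v) 0<1

      on-page-≉0 : ∀ p {x y} → On p (x , y) → ¬ (y ≈ 0#)
      on-page-≉0 p (inside , e) y≈0 = signed≉0 p (hump-pos (lo p) (hi p) inside) (trans (sym e) y≈0)

      private
        0≤1-v : ∀ p {v w} → w ≈ onward p v → [-1,1] w → 0# ≤ 1# - v
        0≤1-v above e (_ , inj₁ w<1) = inj₁ (0<y-x (<-respˡ-≈ e w<1))
        0≤1-v above e (_ , inj₂ w≈1) = inj₂ (sym (x≈y⇒x-y≈0 (trans (sym w≈1) e)))
        0≤1-v below {v} e (inj₁ -1<w , _) = inj₁
          (0<-resp (trans (+-congʳ e) (solve 1 (λ v → (:- v) :- (:- :1) := :1 :- v) refl v)) (0<y-x -1<w))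
        0≤1-v below {v} e (inj₂ -1≈w , _) = inj₂
          (trans (sym (x≈y⇒x-y≈0 (trans (sym e) (sym -1≈w)))) (solve 1 (λ v → (:- v) :- (:- :1) := :1 :- v) refl v))

        reach≉0 : ∀ p → ¬ (reach p ≈ 0#)
        reach≉0 p = span-≢ (span p)

        height : ∀ p {v} → 0# < v → 0# < 1# - v → 0# < (reach p * reach p) * (v * (1# - v))
        height p 0<v 0<1-v = *-pos (square-pos (reach≉0 p)) (*-pos 0<v 0<1-v)

        height-0 : ∀ p {v} → 0# ≈ 1# - v → (reach p * reach p) * (v * (1# - v)) ≈ 0#
        height-0 p {v} e = trans (*-congˡ (trans (*-congˡ (sym e)) (zeroʳ v))) (zeroʳ _)

        along-injective : ∀ p {v u} → along c (foot p) v ≈ along c (foot p) u → v ≈ u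
        along-injective p {v} {u} e = *-cancelˡ (reach≉0 p)
          (trans (solve 3 (λ C d v → d :* v := (C :+ v :* d) :- C) refl (fromℕ c) (reach p) v)
            (trans (+-congʳ e) (solve 3 (λ C d v → (C :+ v :* d) :- C := d :* v) refl (fromℕ c) (reach p) u)))

      module _ (feet : foot below ≢ foot above) where
        private
          -- Ordinates on opposite pages agree only if both vanish, that is for v = u = 1; the
          -- points are then the two ends of the edge, which differ by `feet`.
          opposite : ∀ {v u} → 0# < v → 0# < u → 0# ≤ 1# - v → 0# ≤ 1# - u →
                     along c (foot above) v ≈ along c (foot below) u →
                     (reach above * reach above) * (v * (1# - v)) ≈ - ((reach below * reach below) * (u * (1# - u))) →
                     ∀ {A : Set} → A
          opposite 0<v 0<u (inj₁ 0<1-v) (inj₁ 0<1-u) _ e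
            with () ← signed-page above below (height above 0<v 0<1-v) (height below 0<u 0<1-u) e
          opposite 0<v 0<u (inj₁ 0<1-v) (inj₂ 0≈1-u) _ e = contradiction
            (trans e (trans (-‿cong (height-0 below 0≈1-u)) (solve 0 (:- :0 := :0) refl)))
            (>⇒≉0 (height above 0<v 0<1-v))
          opposite 0<v 0<u (inj₂ 0≈1-v) (inj₁ 0<1-u) _ e = contradiction
            (trans (sym e) (height-0 above 0≈1-v)) (signed≉0 below (height below 0<u 0<1-u))
          opposite {v} {u} 0<v 0<u (inj₂ 0≈1-v) (inj₂ 0≈1-u) e _ = contradiction
            (fromℕ-injective (trans (sym (end below 0≈1-u)) (trans (sym e) (end above 0≈1-v)))) feet
            where
            end : ∀ p {v} → 0# ≈ 1# - v → along c (foot p) v ≈ fromℕ (foot p)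
            end p {v} q = trans (+-congˡ (*-congʳ (sym (x-y≈0⇒x≈y (sym q)))))
              (solve 2 (λ c f → c :+ :1 :* (f :- c) := f) refl (fromℕ c) (fromℕ (foot p)))

          -- On a page the abscissa has moved away from c, by v times a nonzero reach.
          not-mid : ∀ p {v w u} → 0# < v → w ≈ onward p v → u ≈ 0# → ¬ (_≋_ ℝ (place w) (place u))
          not-mid p {v} 0<v e u≈0 (X , _) = >⇒≉0 0<v (x*y≈0⇒y≈0 (reach≉0 p)
            (trans (solve 3 (λ C d v → d :* v := (C :+ v :* d) :- C) refl (fromℕ c) (reach p) v)
              (x≈y⇒x-y≈0 (trans (sym (proj₁ (place-page p 0<v)))
                (trans (sym (proj₁ (place-cong e))) (trans X (proj₁ (place-0 u≈0))))))))

        place-injective : ∀ {w u} → [-1,1] w → [-1,1] u → _≋_ ℝ (place w) (place u) → w ≈ u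
        place-injective {w} {u} w∈ u∈ (X , Y) with side w | side u
        ... | mid w≈0 | mid u≈0 = trans w≈0 (sym u≈0)
        ... | mid w≈0 | page p v 0<v e = contradiction (sym X , sym Y) (not-mid p 0<v e w≈0)
        ... | page p v 0<v e | mid u≈0 = contradiction (X , Y) (not-mid p 0<v e u≈0)
        ... | page p v 0<v e | page q v′ 0<v′ e′ = go p q e e′ 1-v′ 1-v″ X′ Y′
          where
          1-v′ = 0≤1-v p e w∈
          1-v″ = 0≤1-v q e′ u∈
          X′ = trans (sym (proj₁ (place-page p 0<v))) (trans (sym (proj₁ (place-cong e)))
                 (trans X (trans (proj₁ (place-cong e′)) (proj₁ (place-page q 0<v′)))))
          Y′ = trans (sym (proj₂ (place-page p 0<v))) (trans (sym (proj₂ (place-cong e)))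
                 (trans Y (trans (proj₂ (place-cong e′)) (proj₂ (place-page q 0<v′)))))
          go : ∀ p q → w ≈ onward p v → u ≈ onward q v′ → 0# ≤ 1# - v → 0# ≤ 1# - v′ →
               along c (foot p) v ≈ along c (foot q) v′ →
               signed p ((reach p * reach p) * (v * (1# - v))) ≈ signed q ((reach q * reach q) * (v′ * (1# - v′))) →
               w ≈ u
          go above above e e′ _ _ X _ = trans e (trans (along-injective above X) (sym e′))
          go below below e e′ _ _ X _ = trans e (trans (-‿cong (along-injective below X)) (sym e′))
          go above below _ _ p q X Y = opposite 0<v 0<v′ p q X Y
          go below above _ _ p q X Y = opposite 0<v′ 0<v q p (sym X) (sym Y)

-- Representatives of a decidable equivalence on a finite list.

module Enumeration {A : Set} (R : Rel A 0ℓ) (R? : Decidable R)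
  (R-refl : ∀ {x} → R x x) (R-sym : Symmetric R) (R-trans : Transitive R) where

  record Transversal (xs : List A) : Set where
    field
      size      : ℕ
      size≤     : size ℕ.≤ length xs
      pick      : Fin size → A
      distinct  : Injective _≡_ R pick
      represent : ∀ {x} → x ∈ xs → ∃[ i ] R (pick i) x

  transversal : ∀ xs → Transversal xs
  transversal [] = record
    { size = 0 ; size≤ = ℕ.z≤n ; pick = λ () ; distinct = λ { {()} } ; represent = λ () }
  transversal (x ∷ xs) with transversal xs
  ... | record { size = k ; size≤ = k≤ ; pick = pick ; distinct = distinct ; represent = represent }
    with Fin.any? (λ i → R? (pick i) x)
  ... | yes old = record
    { size      = k
    ; size≤     = ℕ.m≤n⇒m≤1+n k≤
    ; pick      = pick
    ; distinct  = distinct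
    ; represent = λ { (here ≡.refl) → old ; (there y∈) → represent y∈ }
    }
  ... | no new = record
    { size      = suc k
    ; size≤     = ℕ.s≤s k≤
    ; pick      = pick′
    ; distinct  = λ {i} {j} → distinct′ i j
    ; represent = λ { (here ≡.refl) → zero , R-refl
                    ; (there y∈) → let i , r = represent y∈ in suc i , r }
    }
    where
    pick′ : Fin (suc k) → A
    pick′ zero    = x
    pick′ (suc i) = pick i

    distinct′ : ∀ i j → R (pick′ i) (pick′ j) → i ≡ j
    distinct′ zero    zero    _ = ≡.refl
    distinct′ zero    (suc j) r = contradiction (j , R-sym r) new
    distinct′ (suc i) zero    r = contradiction (i , r) new
    distinct′ (suc i) (suc j) r = ≡.cong suc (distinct r)

-- Book drawings as combinatorial data.

end : (G : Graph) → Bool → Graph.Edge G → Graph.Vertex G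
end G true  e = proj₁ (Graph.ends G e)
end G false e = proj₂ (Graph.ends G e)

-- Tells whether the end joined on the given page is the first one, for an edge whose flag
-- `startsBelow` is `s`.
firstOn : Page → Bool → Bool
firstOn below s = s
firstOn above s = not s

-- A two-page book drawing of a subdivision of G: the vertices and one subdivision
-- point of each edge lie on the spine, and an edge crosses the spine exactly at its
-- subdivision point, joining it to one end on each page.
record Book (G : Graph) : Set where
  open Graph G
  field
    _≟ₑ_          : DecidableEquality Edge
    pos           : Vertex → ℕ
    pos-injective : Injective _≡_ _≡_ pos
    mid           : Edge → ℕ
    mid-injective : Injective _≡_ _≡_ mid
    mid≢pos       : ∀ e v → mid e ≢ pos v
    startsBelow   : Edge → Bool
    lo hi         : Page → Edge → ℕ

  foot : Page → Edge → Vertex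
  foot p e = end G (firstOn p (startsBelow e)) e

  field
    span : ∀ p e → Span (mid e) (pos (foot p e)) (lo p e) (hi p e)

  Interleave : Page → Edge → Edge → Set
  Interleave p e f = lo p e ℕ.< lo p f × lo p f ℕ.< hi p e × hi p e ℕ.< hi p f

  interleave? : ∀ p e f → Dec (Interleave p e f)
  interleave? p e f = lo p e ℕ.<? lo p f ×-dec lo p f ℕ.<? hi p e ×-dec hi p e ℕ.<? hi p f

-- The drawing of a book, with its crossings as interleaving arcs.

module BookDrawing (ℝ : RealField) {G : Graph} (B : Book G) where
  open Graph G
  open Book B
  open OrderedField ℝ
  open LipschitzFunctions ℝ
  open Parabolas ℝ
  open Arcs ℝ
  module ArcOf (e : Edge) = Arc (mid e) (λ p → pos (foot p e))
  module SpanOf (e : Edge) = ArcOf.Spanned e (λ p → lo p e) (λ p → hi p e) (λ p → span p e)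

  ≋-trans : ∀ {x y z : Plane ℝ} → _≋_ ℝ x y → _≋_ ℝ y z → _≋_ ℝ x z
  ≋-trans (p , q) (p′ , q′) = trans p p′ , trans q q′

  ≋-sym : ∀ {x y : Plane ℝ} → _≋_ ℝ x y → _≋_ ℝ y x
  ≋-sym (p , q) = sym p , sym q

  feet≢ : ∀ e → pos (foot below e) ≢ pos (foot above e)
  feet≢ e p = go (startsBelow e) (pos-injective p)
    where
    go : ∀ s → end G s e ≢ end G (not s) e
    go true  q = loopless e q
    go false q = loopless e (≡.sym q)

  arc : Edge → Carrier → Plane ℝ
  arc e t = ArcOf.place e (param (startsBelow e) t)

  vertexPoint : Vertex → Plane ℝ
  vertexPoint v = fromℕ (pos v) , 0#

  vertexPoint-cong : ∀ {u v} → u ≡ v → _≋_ ℝ (vertexPoint u) (vertexPoint v)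
  vertexPoint-cong u≡v = reflexive (≡.cong (λ v → fromℕ (pos v)) u≡v) , refl

  arc-0 : ∀ e → _≋_ ℝ (arc e 0#) (vertexPoint (proj₁ (ends e)))
  arc-0 e = go (startsBelow e) ≡.refl
    where
    go : ∀ s → startsBelow e ≡ s → _≋_ ℝ (ArcOf.place e (param s 0#)) (vertexPoint (end G true e))
    go true  q = ≋-trans (ArcOf.place-cong e (param-start true))
      (≋-trans (ArcOf.place-foot e below) (vertexPoint-cong (≡.cong (λ s → end G s e) q)))
    go false q = ≋-trans (ArcOf.place-cong e (param-start false))
      (≋-trans (ArcOf.place-foot e above) (vertexPoint-cong (≡.cong (λ s → end G (not s) e) q)))

  arc-1 : ∀ e → _≋_ ℝ (arc e 1#) (vertexPoint (proj₂ (ends e)))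
  arc-1 e = go (startsBelow e) ≡.refl
    where
    go : ∀ s → startsBelow e ≡ s → _≋_ ℝ (ArcOf.place e (param s 1#)) (vertexPoint (end G false e))
    go true  q = ≋-trans (ArcOf.place-cong e (param-finish true))
      (≋-trans (ArcOf.place-foot e above) (vertexPoint-cong (≡.cong (λ s → end G (not s) e) q)))
    go false q = ≋-trans (ArcOf.place-cong e (param-finish false))
      (≋-trans (ArcOf.place-foot e below) (vertexPoint-cong (≡.cong (λ s → end G s e) q)))

  location : ∀ e {t} → ]0,1[ ℝ t → SpanOf.Location e (param (startsBelow e) t)
  location e t∈ = SpanOf.location e (param-open (startsBelow e) t∈)

  avoid : ∀ e t → ]0,1[ ℝ t → ∀ v → ¬ (_≋_ ℝ (arc e t) (vertexPoint v))
  avoid e t t∈ v (X , Y) with location e t∈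
  ... | SpanOf.at-mid w≈0  = mid≢pos e v (fromℕ-injective (trans (sym (proj₁ (ArcOf.place-0 e w≈0))) X))
  ... | SpanOf.on-page p on = SpanOf.on-page-≉0 e p on Y

  drawing : Drawing ℝ G
  drawing = record
    { point            = vertexPoint
    ; point-injective  = λ (X , _) → pos-injective (fromℕ-injective X)
    ; arc              = arc
    ; arc-continuous   = λ e → lipschitz⇒continuous
        (ArcOf.abscissa-lipschitz e (param-lipschitz (startsBelow e)))
        (ArcOf.ordinate-lipschitz e (param-lipschitz (startsBelow e)))
    ; arc-injective    = λ e s t s∈ t∈ st → param-injective (startsBelow e)
        (SpanOf.place-injective e (feet≢ e) (param-closed (startsBelow e) s∈) (param-closed (startsBelow e) t∈) st)
    ; arc-start        = arc-0
    ; arc-end          = arc-1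
    ; arc-avoids-point = avoid
    }

  -- Each interval has the subdivision point of its edge as one end. If it is the same end for both
  -- edges, `mid-injective` applies; otherwise a subdivision point would coincide with a vertex.
  span-unique : ∀ p e f → lo p e ≡ lo p f → hi p e ≡ hi p f → e ≡ f
  span-unique p e f = go (span p e) (span p f)
    where
    go : ∀ {l h l′ h′} → Span (mid e) (pos (foot p e)) l h → Span (mid f) (pos (foot p f)) l′ h′ →
         l ≡ l′ → h ≡ h′ → e ≡ f
    go (fwd _) (fwd _) q _ = mid-injective q
    go (bwd _) (bwd _) _ q = mid-injective q
    go (fwd _) (bwd _) q _ = contradiction q (mid≢pos e _)
    go (bwd _) (fwd _) q _ = contradiction (≡.sym q) (mid≢pos f _)

  -- For interleaving `e` and `f` this pins down a single point, so that a crossing is determined by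
  -- its page and its pair of edges.
  CrossingAt : Page → Edge → Edge → Plane ℝ → Set
  CrossingAt p e f (x , y) =
    Meet (lo p e) (hi p e) (lo p f) (hi p f) x × y ≈ signed p (hump (fromℕ (lo p e)) (fromℕ (hi p e)) x)

  crossingAt-unique : ∀ p e f → Interleave p e f → ∀ {z z′} → CrossingAt p e f z → CrossingAt p e f z′ → _≋_ ℝ z z′
  crossingAt-unique p e f (l<l′ , _ , h<h′) (m , Y) (m′ , Y′) =
    x≈x′ , trans Y (trans (signed-cong p (hump-cong _ _ x≈x′)) (sym Y′))
    where
    x≈x′ = meet-unique l<l′ h<h′ m m′

  hit : ∀ e p {x} → Inside (lo p e) (hi p e) x →
        ∃[ t ] ]0,1[ ℝ t × _≋_ ℝ (arc e t) (x , signed p (hump (fromℕ (lo p e)) (fromℕ (hi p e)) x))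
  hit e p inside =
    let w , w∈ , w≋ = SpanOf.onto-page e p inside
        t , t∈ , t≈ = param-onto (startsBelow e) w∈
    in t , t∈ , ≋-trans (ArcOf.place-cong e t≈) w≋

  abstract
    interleave⇒crossing : ∀ p e f → Interleave p e f →
      Σ[ x ∈ Crossing ℝ drawing ] Crossing.e x ≡ e × Crossing.f x ≡ f × CrossingAt p e f (arc e (Crossing.s x))
    interleave⇒crossing p e f (l<l′ , l′<h , h<h′) =
      let x , (l′<x , x<h) , meet = meet-exists l<l′ h<h′ l′<h
          s , s∈ , X , Y = hit e p (<-trans (fromℕ-mono l<l′) l′<x , x<h)
          t , t∈ , X′ , Y′ = hit f p (l′<x , <-trans x<h (fromℕ-mono h<h′))
      in record
         { e = e ; f = f ; e≢f = λ e≡f → ℕ.<-irrefl (≡.cong (lo p) e≡f) l<l′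
         ; s = s ; t = t ; s∈ = s∈ ; t∈ = t∈
         ; meet = trans X (sym X′) , trans Y (trans (signed-cong p meet) (sym Y′))
         } , ≡.refl , ≡.refl ,
         ( trans (hump-cong _ _ X) (trans meet (hump-cong _ _ (sym X)))
         , trans Y (signed-cong p (hump-cong _ _ (sym X))))

  -- Two cases because `Interleave` is ordered from left to right, whereas the edges of a crossing
  -- come in either order.
  data Located (e f : Edge) (z : Plane ℝ) : Set where
    inOrder  : ∀ p → Interleave p e f → CrossingAt p e f z → Located e f z
    reversed : ∀ p → Interleave p f e → CrossingAt p f e z → Located e f z

  -- The common point is off the axis: subdivision points of distinct edges differ, and all other
  -- interior points have nonzero ordinate. The sign of the ordinate puts both arcs on one page,
  -- where `meet⇒interleave` applies.
  crossing⇒interleave : ∀ e f → e ≢ f → ∀ {s t} → ]0,1[ ℝ s → ]0,1[ ℝ t → _≋_ ℝ (arc e s) (arc f t) →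
                        Located e f (arc e s)
  crossing⇒interleave e f e≢f s∈ t∈ (X , Y) with location e s∈ | location f t∈
  ... | SpanOf.at-mid w≈0 | SpanOf.at-mid u≈0 = contradiction (mid-injective (fromℕ-injective
    (trans (sym (proj₁ (ArcOf.place-0 e w≈0))) (trans X (proj₁ (ArcOf.place-0 f u≈0)))))) e≢f
  ... | SpanOf.at-mid w≈0 | SpanOf.on-page p on = contradiction
    (trans (sym Y) (proj₂ (ArcOf.place-0 e w≈0))) (SpanOf.on-page-≉0 f p on)
  ... | SpanOf.on-page p on | SpanOf.at-mid u≈0 = contradiction
    (trans Y (proj₂ (ArcOf.place-0 f u≈0))) (SpanOf.on-page-≉0 e p on)
  ... | SpanOf.on-page p (in₁ , Y₁) | SpanOf.on-page q (in₂ , Y₂)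
    with ≡.refl ← signed-page p q (hump-pos (lo p e) (hi p e) in₁) (hump-pos (lo q f) (hi q f) in₂)
                    (trans (sym Y₁) (trans Y Y₂))
    with in₂′ ← inside-resp {lo p f} {hi p f} (sym X) in₂
    with meet ← trans (signed-injective p (trans (sym Y₁) (trans Y Y₂))) (hump-cong (fromℕ (lo p f)) (fromℕ (hi p f)) (sym X))
    with meet⇒interleave (lo p e) (hi p e) (lo p f) (hi p f) in₁ in₂′ meet
  -- The common point lies to the right of `lo p f` and to the left of `hi p e`, whence the middle
  -- inequality.
  ... | inj₁ (l<l′ , h<h′) = inOrder p
    (l<l′ , fromℕ-cancel-< (<-trans (proj₁ in₂′) (proj₂ in₁)) , h<h′) (meet , Y₁)
  ... | inj₂ (inj₁ (l′<l , h′<h)) = reversed p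
    (l′<l , fromℕ-cancel-< (<-trans (proj₁ in₁) (proj₂ in₂′)) , h′<h) (sym meet , trans Y₁ (signed-cong p meet))
  ... | inj₂ (inj₂ (l≡l′ , h≡h′)) = contradiction (span-unique p e f l≡l′ h≡h′) e≢f

  Same : Rel (Crossing ℝ drawing) 0ℓ
  Same = SameCrossing ℝ drawing

  same? : Decidable Same
  same? x y = ((x.e ≟ₑ y.e ×-dec x.f ≟ₑ y.f) ⊎-dec (x.e ≟ₑ y.f ×-dec x.f ≟ₑ y.e)) ×-dec
    ((proj₁ (arc x.e x.s) ≟ proj₁ (arc y.e y.s)) ×-dec (proj₂ (arc x.e x.s) ≟ proj₂ (arc y.e y.s)))
    where
    module x = Crossing x
    module y = Crossing y

  same-refl : ∀ {x} → Same x x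
  same-refl = inj₁ (≡.refl , ≡.refl) , refl , refl

  same-sym : Symmetric Same
  same-sym (inj₁ (p , q) , z) = inj₁ (≡.sym p , ≡.sym q) , ≋-sym z
  same-sym (inj₂ (p , q) , z) = inj₂ (≡.sym q , ≡.sym p) , ≋-sym z

  same-trans : Transitive Same
  same-trans (inj₁ (p , q) , z) (inj₁ (p′ , q′) , z′) = inj₁ (≡.trans p p′ , ≡.trans q q′) , ≋-trans z z′
  same-trans (inj₁ (p , q) , z) (inj₂ (p′ , q′) , z′) = inj₂ (≡.trans p p′ , ≡.trans q q′) , ≋-trans z z′
  same-trans (inj₂ (p , q) , z) (inj₁ (p′ , q′) , z′) = inj₂ (≡.trans p q′ , ≡.trans q p′) , ≋-trans z z′
  same-trans (inj₂ (p , q) , z) (inj₂ (p′ , q′) , z′) = inj₁ (≡.trans p q′ , ≡.trans q p′) , ≋-trans z z′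

  open Enumeration Same same? (λ {x} → same-refl {x}) (λ {x y} → same-sym {x} {y})
    (λ {x y z} → same-trans {x} {y} {z})

  -- Codes are plain data, so their list can be written down in advance. It may contain codes of no
  -- edge or of arcs that do not cross; it only has to be complete.
  module Bound {K : Set} (code : Edge → K) (decode : K → Maybe Edge) (decode-code : ∀ e → decode (code e) ≡ just e)
    (codes : List (Page × K × K)) (complete : ∀ p e f → Interleave p e f → (p , code e , code f) ∈ codes) where

    crossingOf : Page × K × K → Maybe (Crossing ℝ drawing)
    crossingOf (p , k , l) with decode k | decode l
    ... | nothing | _       = nothing
    ... | just e  | nothing = nothing
    ... | just e  | just f with interleave? p e f
    ...   | yes i = just (proj₁ (interleave⇒crossing p e f i))
    ...   | no  _ = nothing

    -- The crossing is built from a proof of interleaving, and the proof found by the test need not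
    -- be the given one; hence the existential.
    crossingOf-code : ∀ p e f → Interleave p e f →
      ∃[ i ] crossingOf (p , code e , code f) ≡ just (proj₁ (interleave⇒crossing p e f i))
    crossingOf-code p e f i rewrite decode-code e | decode-code f with interleave? p e f
    ... | yes j = j , ≡.refl
    ... | no ¬i = contradiction i ¬i

    length-mapMaybe≤ : ∀ {A B : Set} (g : A → Maybe B) xs → length (mapMaybe g xs) ℕ.≤ length xs
    length-mapMaybe≤ g [] = ℕ.z≤n
    length-mapMaybe≤ g (x ∷ xs) with g x
    ... | just _  = ℕ.s≤s (length-mapMaybe≤ g xs)
    ... | nothing = ℕ.m≤n⇒m≤1+n (length-mapMaybe≤ g xs)

    ∈-mapMaybe : ∀ {A B : Set} (g : A → Maybe B) {x y} {xs} → x ∈ xs → g x ≡ just y → y ∈ mapMaybe g xs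
    ∈-mapMaybe g {xs = x ∷ xs} (here ≡.refl) e rewrite e = here ≡.refl
    ∈-mapMaybe g {xs = x ∷ xs} (there x∈) e with g x
    ... | just _  = there (∈-mapMaybe g x∈ e)
    ... | nothing = ∈-mapMaybe g x∈ e

    crossings : List (Crossing ℝ drawing)
    crossings = mapMaybe crossingOf codes

    listed : ∀ p e f → Interleave p e f →
      Σ[ y ∈ Crossing ℝ drawing ] y ∈ crossings × Crossing.e y ≡ e × Crossing.f y ≡ f ×
        CrossingAt p e f (arc e (Crossing.s y))
    listed p e f i =
      let j , eq = crossingOf-code p e f i
          y , rest = interleave⇒crossing p e f j
      in y , ∈-mapMaybe crossingOf (complete p e f i) eq , rest

    -- A pair of edges meets at most once on a page with given left-to-right order, so the listed
    -- crossing is at the same point; in the case `reversed` it names the edges in the other order.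
    all-listed : ∀ x → ∃[ y ] y ∈ crossings × Same y x
    all-listed x with crossing⇒interleave x.e x.f x.e≢f x.s∈ x.t∈ x.meet
      where module x = Crossing x
    ... | inOrder p i at with listed p _ _ i
    ...   | y , y∈ , ≡.refl , ≡.refl , at′ = y , y∈ , inj₁ (≡.refl , ≡.refl) , crossingAt-unique p _ _ i at′ at
    all-listed x | reversed p i at with listed p _ _ i
    ...   | y , y∈ , ≡.refl , ≡.refl , at′ = y , y∈ , inj₂ (≡.refl , ≡.refl) , crossingAt-unique p _ _ i at′ at

    open Transversal (transversal crossings)

    hasCrossings : HasCrossings ℝ drawing size
    hasCrossings = pick , distinct , λ x →
      let y , y∈ , y~x = all-listed x
          i , i~y = represent y∈
      in i , same-trans {pick i} {y} {x} i~y y~x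

    size≤codes : size ℕ.≤ length codes
    size≤codes = ℕ.≤-trans size≤ (length-mapMaybe≤ crossingOf codes)

    crossingNumber≤ : CrossingNumberAtMost ℝ G (length codes)
    crossingNumber≤ = record
      { drawing = drawing , size , hasCrossings , size≤codes
      ; bound   = λ c isCr → ℕ.≤-trans (IsCrossingNumber.minimal isCr drawing size hasCrossings) size≤codes
      }

-- Parity words and the list of potential crossings.

keep : {A : Set} → Parity → Parity → List A → List A
keep 0ℙ 0ℙ xs = xs
keep 1ℙ 1ℙ xs = xs
keep 0ℙ 1ℙ _  = []
keep 1ℙ 0ℙ _  = []

keep-refl : {A : Set} (p : Parity) (xs : List A) → keep p p xs ≡ xs
keep-refl 0ℙ _ = ≡.refl
keep-refl 1ℙ _ = ≡.refl

-- The decreasing sequences of naturals below n whose parities form the given word.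
chains : List Parity → ℕ → List (List ℕ)
chains []      _       = [] ∷ []
chains (_ ∷ _) zero    = []
chains (p ∷ w) (suc n) = chains (p ∷ w) n ++ keep (parity n) p (map (n ∷_) (chains w n))

∈-chains : ∀ {x n w xs} → x ℕ.< n → xs ∈ chains w x → (x ∷ xs) ∈ chains (parity x ∷ w) n
∈-chains {x} {suc n} {w} {xs} x<1+n xs∈ with x ℕ.≟ n
... | yes ≡.refl = ∈-++⁺ʳ (chains (parity x ∷ w) x)
  (≡.subst ((x ∷ xs) ∈_) (≡.sym (keep-refl (parity x) (map (x ∷_) (chains w x)))) (∈-map⁺ (x ∷_) xs∈))
... | no x≢n = ∈-++⁺ˡ (∈-chains (ℕ.≤∧≢⇒< (ℕ.s≤s⁻¹ x<1+n) x≢n) xs∈)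

chains₂ : (Parity → Parity → List Parity) → ℕ → List (List ℕ)
chains₂ w n = chains (w 0ℙ 0ℙ) n ++ chains (w 0ℙ 1ℙ) n ++ chains (w 1ℙ 0ℙ) n ++ chains (w 1ℙ 1ℙ) n

∈-chains₂ : ∀ w p q n {xs} → xs ∈ chains (w p q) n → xs ∈ chains₂ w n
∈-chains₂ w 0ℙ 0ℙ n xs∈ = ∈-++⁺ˡ xs∈
∈-chains₂ w 0ℙ 1ℙ n xs∈ = ∈-++⁺ʳ (chains (w 0ℙ 0ℙ) n) (∈-++⁺ˡ xs∈)
∈-chains₂ w 1ℙ 0ℙ n xs∈ = ∈-++⁺ʳ (chains (w 0ℙ 0ℙ) n) (∈-++⁺ʳ (chains (w 0ℙ 1ℙ) n) (∈-++⁺ˡ xs∈))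
∈-chains₂ w 1ℙ 1ℙ n xs∈ = ∈-++⁺ʳ (chains (w 0ℙ 0ℙ) n) (∈-++⁺ʳ (chains (w 0ℙ 1ℙ) n) (∈-++⁺ʳ (chains (w 1ℙ 0ℙ) n) xs∈))

-- Read from the largest index down. Each pattern is closed under reversal, so it may be stated from
-- either end.
nestedWord adjacentWord alternatingWord : Parity → Parity → List Parity
nestedWord      p q = p ∷ q ∷ q ∷ p ∷ []
adjacentWord    p q = p ∷ p ∷ q ∷ q ∷ []
alternatingWord p q = p ∷ q ∷ p ⁻¹ ∷ q ⁻¹ ∷ []

module _ (n : ℕ) {k j i h : ℕ} (h<i : h ℕ.< i) (i<j : i ℕ.< j) (j<k : j ℕ.< k) (k<n : k ℕ.< n) where

  private
    chain : (k ∷ j ∷ i ∷ h ∷ []) ∈ chains (parity k ∷ parity j ∷ parity i ∷ parity h ∷ []) n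
    chain = ∈-chains k<n (∈-chains j<k (∈-chains i<j (∈-chains h<i (here ≡.refl))))

  ∈-nested : parity h ≡ parity k → parity i ≡ parity j → (k ∷ j ∷ i ∷ h ∷ []) ∈ chains₂ nestedWord n
  ∈-nested p q = ∈-chains₂ nestedWord (parity k) (parity j) n
    (≡.subst₂ (λ x y → (k ∷ j ∷ i ∷ h ∷ []) ∈ chains (parity k ∷ parity j ∷ x ∷ y ∷ []) n) q p chain)

  ∈-adjacent : parity h ≡ parity i → parity j ≡ parity k → (k ∷ j ∷ i ∷ h ∷ []) ∈ chains₂ adjacentWord n
  ∈-adjacent p q = ∈-chains₂ adjacentWord (parity k) (parity i) n
    (≡.subst₂ (λ x y → (k ∷ j ∷ i ∷ h ∷ []) ∈ chains (parity k ∷ x ∷ parity i ∷ y ∷ []) n) q p chain)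

  ∈-alternating : parity h ≡ parity j ⁻¹ → parity i ≡ parity k ⁻¹ → (k ∷ j ∷ i ∷ h ∷ []) ∈ chains₂ alternatingWord n
  ∈-alternating p q = ∈-chains₂ alternatingWord (parity k) (parity j) n
    (≡.subst₂ (λ x y → (k ∷ j ∷ i ∷ h ∷ []) ∈ chains (parity k ∷ parity j ∷ x ∷ y ∷ []) n) q p chain)

-- The kind of an edge and its two indices, the smaller one first.  An edge between the
-- clusters is direct if its eastern index is the smaller one.
data Tag : Set where
  around direct inEast inWest : Tag

Code : Set
Code = Tag × ℕ × ℕ

-- Two edges of the same kind between the clusters cross above when their index intervals are
-- nested. A direct edge and one going around cross when these are disjoint: below if the direct one
-- has the larger indices, above otherwise. Two edges inside one cluster cross when the intervals
-- interleave.
nestedCodes adjacentCodes alternatingCodes : List ℕ → List (Page × Code × Code)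
nestedCodes (k ∷ j ∷ i ∷ h ∷ []) =
  (above , (around , h , k) , (around , i , j)) ∷ (above , (direct , i , j) , (direct , h , k)) ∷ []
nestedCodes _ = []
adjacentCodes (k ∷ j ∷ i ∷ h ∷ []) =
  (below , (direct , j , k) , (around , h , i)) ∷ (above , (direct , h , i) , (around , j , k)) ∷ []
adjacentCodes _ = []
alternatingCodes (k ∷ j ∷ i ∷ h ∷ []) =
  (above , (inEast , h , j) , (inEast , i , k)) ∷ (below , (inWest , h , j) , (inWest , i , k)) ∷ []
alternatingCodes _ = []

codes : ℕ → List (Page × Code × Code)
codes n = concatMap nestedCodes (chains₂ nestedWord n)
       ++ concatMap adjacentCodes (chains₂ adjacentWord n)
       ++ concatMap alternatingCodes (chains₂ alternatingWord n)

∈-concatMap : ∀ {A B : Set} (f : A → List B) {x y xs} → x ∈ xs → y ∈ f x → y ∈ concatMap f xs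
∈-concatMap f {xs = z ∷ xs} (here ≡.refl) y∈ = ∈-++⁺ˡ y∈
∈-concatMap f {xs = z ∷ xs} (there x∈)    y∈ = ∈-++⁺ʳ (f z) (∈-concatMap f x∈ y∈)

nested∈ : ∀ n {x y} → x ∈ chains₂ nestedWord n → y ∈ nestedCodes x → y ∈ codes n
nested∈ n x∈ y∈ = ∈-++⁺ˡ (∈-concatMap nestedCodes {xs = chains₂ nestedWord n} x∈ y∈)

adjacent∈ : ∀ n {x y} → x ∈ chains₂ adjacentWord n → y ∈ adjacentCodes x → y ∈ codes n
adjacent∈ n x∈ y∈ = ∈-++⁺ʳ (concatMap nestedCodes (chains₂ nestedWord n))
  (∈-++⁺ˡ (∈-concatMap adjacentCodes {xs = chains₂ adjacentWord n} x∈ y∈))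

alternating∈ : ∀ n {x y} → x ∈ chains₂ alternatingWord n → y ∈ alternatingCodes x → y ∈ codes n
alternating∈ n x∈ y∈ = ∈-++⁺ʳ (concatMap nestedCodes (chains₂ nestedWord n))
  (∈-++⁺ʳ (concatMap adjacentCodes (chains₂ adjacentWord n)) (∈-concatMap alternatingCodes {xs = chains₂ alternatingWord n} x∈ y∈))

-- A zone, numbered from left to right, and a place in it, all compared lexicographically.
Spot : Set
Spot = ℕ × ℕ × ℕ

-- Recursion on the zone numbers makes a comparison of spots in literal zones compute to `⊤`, `⊥` or
-- the comparison of places, so that distinct zones are settled by `tt` or `()`.
Lex : ℕ → ℕ → Set → Set
Lex zero    zero    P = P
Lex zero    (suc _) P = ⊤
Lex (suc _) zero    P = ⊥
Lex (suc x) (suc y) P = Lex x y P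

_≺₂_ : ℕ × ℕ → ℕ × ℕ → Set
(u , v) ≺₂ (u′ , v′) = u ℕ.< u′ ⊎ (u ≡ u′ × v ℕ.< v′)

_≺_ : Spot → Spot → Set
(z , p) ≺ (z′ , p′) = Lex z z′ (p ≺₂ p′)

lex-< : ∀ {x y P} → x ℕ.< y → Lex x y P
lex-< {zero}  {suc _} _           = tt
lex-< {suc x} {suc y} (ℕ.s≤s x<y) = lex-< {x} {y} x<y

lex-refl : ∀ x {P} → P → Lex x x P
lex-refl zero    p = p
lex-refl (suc x) p = lex-refl x p

lex⁻ : ∀ x y {P} → Lex x y P → x ℕ.< y ⊎ (x ≡ y × P)
lex⁻ zero    zero    p = inj₂ (≡.refl , p)
lex⁻ zero    (suc y) _ = inj₁ (ℕ.s≤s ℕ.z≤n)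
lex⁻ (suc x) (suc y) p with lex⁻ x y p
... | inj₁ x<y          = inj₁ (ℕ.s≤s x<y)
... | inj₂ (≡.refl , q) = inj₂ (≡.refl , q)

-- Spots along the axis, and which arcs between them interleave.

module Layout (n : ℕ) where

  base : ℕ
  base = suc n

  digit-< : ∀ {u u′ v} v′ → u ℕ.< u′ → v ℕ.≤ n → u ℕ.* base ℕ.+ v ℕ.< u′ ℕ.* base ℕ.+ v′
  digit-< {u} {u′} {v} v′ u<u′ v≤n = begin-strict
    u ℕ.* base ℕ.+ v      <⟨ ℕ.+-monoʳ-< (u ℕ.* base) (ℕ.s≤s v≤n) ⟩
    u ℕ.* base ℕ.+ base   ≡⟨ ℕ.+-comm (u ℕ.* base) base ⟩
    suc u ℕ.* base        ≤⟨ ℕ.*-monoˡ-≤ base u<u′ ⟩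
    u′ ℕ.* base           ≤⟨ ℕ.m≤m+n (u′ ℕ.* base) v′ ⟩
    u′ ℕ.* base ℕ.+ v′    ∎
    where open ℕ.≤-Reasoning

  -- A numeral in base n + 1 with leading digit z; as `Small` bounds the other two digits by n,
  -- numerical order is lexicographic order.
  rank : Spot → ℕ
  rank (z , u , v) = (z ℕ.* base ℕ.+ u) ℕ.* base ℕ.+ v

  Small : Spot → Set
  Small (_ , u , v) = u ℕ.≤ n × v ℕ.≤ n

  rank-mono : ∀ {s t} → Small s → s ≺ t → rank s ℕ.< rank t
  rank-mono {z , u , v} {z′ , u′ , v′} (u≤n , v≤n) s≺t with lex⁻ z z′ s≺t
  ... | inj₁ z<z′                           = digit-< v′ (digit-< u′ z<z′ u≤n) v≤n
  ... | inj₂ (≡.refl , inj₁ u<u′)           = digit-< v′ (ℕ.+-monoʳ-< (z ℕ.* base) u<u′) v≤n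
  ... | inj₂ (≡.refl , inj₂ (≡.refl , v<v′)) = ℕ.+-monoʳ-< ((z ℕ.* base ℕ.+ u) ℕ.* base) v<v′

  ≺-cmp : ∀ s t → s ≺ t ⊎ (s ≡ t ⊎ t ≺ s)
  ≺-cmp (z , u , v) (z′ , u′ , v′) with ℕ.<-cmp z z′ | ℕ.<-cmp u u′ | ℕ.<-cmp v v′
  ... | tri< z<z′ _ _   | _               | _               = inj₁ (lex-< z<z′)
  ... | tri> _ _ z′<z   | _               | _               = inj₂ (inj₂ (lex-< z′<z))
  ... | tri≈ _ ≡.refl _ | tri< u<u′ _ _   | _               = inj₁ (lex-refl z (inj₁ u<u′))
  ... | tri≈ _ ≡.refl _ | tri> _ _ u′<u   | _               = inj₂ (inj₂ (lex-refl z (inj₁ u′<u)))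
  ... | tri≈ _ ≡.refl _ | tri≈ _ ≡.refl _ | tri< v<v′ _ _   = inj₁ (lex-refl z (inj₂ (≡.refl , v<v′)))
  ... | tri≈ _ ≡.refl _ | tri≈ _ ≡.refl _ | tri> _ _ v′<v   = inj₂ (inj₂ (lex-refl z (inj₂ (≡.refl , v′<v))))
  ... | tri≈ _ ≡.refl _ | tri≈ _ ≡.refl _ | tri≈ _ ≡.refl _ = inj₂ (inj₁ ≡.refl)

  rank-cancel : ∀ {s t} → Small t → rank s ℕ.< rank t → s ≺ t
  rank-cancel {s} {t} small r with ≺-cmp s t
  ... | inj₁ s≺t           = s≺t
  ... | inj₂ (inj₁ ≡.refl) = contradiction r (ℕ.<-irrefl ≡.refl)
  ... | inj₂ (inj₂ t≺s)    = contradiction r (ℕ.<-asym (rank-mono {t} {s} small t≺s))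

  rank-injective : ∀ {s t} → Small s → Small t → rank s ≡ rank t → s ≡ t
  rank-injective {s} {t} small-s small-t r with ≺-cmp s t
  ... | inj₁ s≺t        = contradiction (rank-mono {s} {t} small-s s≺t) (ℕ.<-irrefl r)
  ... | inj₂ (inj₁ s≡t) = s≡t
  ... | inj₂ (inj₂ t≺s) = contradiction (rank-mono {t} {s} small-t t≺s) (ℕ.<-irrefl (≡.sym r))

  west east : ℕ → Spot
  west m = 0 , m , 0
  east m = 2 , m , 0

  -- Subtraction from n reverses the order, so that the arcs leaving the same cluster, or
  -- the same vertex, on the side of the crossing points are nested.
  midSpot : Code → Spot
  midSpot (inWest , m , M) = 0 , m , n ℕ.∸ M
  midSpot (direct , m , M) = 1 , n ℕ.∸ m , n ℕ.∸ M
  midSpot (inEast , m , M) = 2 , m , n ℕ.∸ M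
  midSpot (around , m , M) = 3 , n ℕ.∸ M , n ℕ.∸ m

  -- An edge inside a cluster has its subdivision point just to the right of its smaller end, before
  -- the next vertex. One of its two arcs is therefore short and crosses nothing.
  loSpot hiSpot : Page → Code → Spot
  loSpot below (around , m , M)   = east M
  loSpot below c@(direct , m , M) = midSpot c
  loSpot below (inEast , m , M)   = east m
  loSpot below c@(inWest , m , M) = midSpot c
  loSpot above (around , m , M)   = west m
  loSpot above (direct , m , M)   = west M
  loSpot above c@(inEast , m , M) = midSpot c
  loSpot above (inWest , m , M)   = west m
  hiSpot below c@(around , m , M) = midSpot c
  hiSpot below (direct , m , M)   = east m
  hiSpot below c@(inEast , m , M) = midSpot c
  hiSpot below (inWest , m , M)   = west M
  hiSpot above c@(around , m , M) = midSpot c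
  hiSpot above c@(direct , m , M) = midSpot c
  hiSpot above (inEast , m , M)   = east M
  hiSpot above c@(inWest , m , M) = midSpot c

  Related : Tag → Parity → Parity → Set
  Related around p q = p ≡ q
  Related direct p q = p ≡ q
  Related inEast p q = p ≡ q ⁻¹
  Related inWest p q = p ≡ q ⁻¹

  Valid : Code → Set
  Valid (t , m , M) = m ℕ.< M × M ℕ.< n × Related t (parity m) (parity M)

  rev-< : ∀ {x y} → y ℕ.≤ n → x ℕ.< y → n ℕ.∸ y ℕ.< n ℕ.∸ x
  rev-< y≤n x<y = ℕ.∸-monoʳ-< x<y y≤n

  small-mid : ∀ c → Valid c → Small (midSpot c)
  small-mid (inWest , m , M) (m<M , M<n , _) = ℕ.<⇒≤ (ℕ.<-trans m<M M<n) , ℕ.m∸n≤m n M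
  small-mid (direct , m , M) _               = ℕ.m∸n≤m n m , ℕ.m∸n≤m n M
  small-mid (inEast , m , M) (m<M , M<n , _) = ℕ.<⇒≤ (ℕ.<-trans m<M M<n) , ℕ.m∸n≤m n M
  small-mid (around , m , M) _               = ℕ.m∸n≤m n M , ℕ.m∸n≤m n m

  small-lo : ∀ p c → Valid c → Small (loSpot p c)
  small-lo below (around , m , M)   (_ , M<n , _)   = ℕ.<⇒≤ M<n , ℕ.z≤n
  small-lo below c@(direct , _ , _) v               = small-mid c v
  small-lo below (inEast , m , M)   (m<M , M<n , _) = ℕ.<⇒≤ (ℕ.<-trans m<M M<n) , ℕ.z≤n
  small-lo below c@(inWest , _ , _) v               = small-mid c v
  small-lo above (around , m , M)   (m<M , M<n , _) = ℕ.<⇒≤ (ℕ.<-trans m<M M<n) , ℕ.z≤n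
  small-lo above (direct , m , M)   (_ , M<n , _)   = ℕ.<⇒≤ M<n , ℕ.z≤n
  small-lo above c@(inEast , _ , _) v               = small-mid c v
  small-lo above (inWest , m , M)   (m<M , M<n , _) = ℕ.<⇒≤ (ℕ.<-trans m<M M<n) , ℕ.z≤n

  small-hi : ∀ p c → Valid c → Small (hiSpot p c)
  small-hi below c@(around , _ , _) v               = small-mid c v
  small-hi below (direct , m , M)   (m<M , M<n , _) = ℕ.<⇒≤ (ℕ.<-trans m<M M<n) , ℕ.z≤n
  small-hi below c@(inEast , _ , _) v               = small-mid c v
  small-hi below (inWest , m , M)   (_ , M<n , _)   = ℕ.<⇒≤ M<n , ℕ.z≤n
  small-hi above c@(around , _ , _) v               = small-mid c v
  small-hi above c@(direct , _ , _) v               = small-mid c v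
  small-hi above (inEast , m , M)   (_ , M<n , _)   = ℕ.<⇒≤ M<n , ℕ.z≤n
  small-hi above c@(inWest , _ , _) v               = small-mid c v

  -- The subdivision points attached to the vertex with index x precede the next vertex of the
  -- cluster; this rules out crossings on the short arcs.
  sandwich : ∀ {x y v} → (x , 0) ≺₂ (y , 0) → ¬ ((y , 0) ≺₂ (x , v))
  sandwich (inj₁ x<y) (inj₁ y<x)         = ℕ.<-asym x<y y<x
  sandwich (inj₁ x<y) (inj₂ (≡.refl , _)) = ℕ.<-irrefl ≡.refl x<y

  ≺₂-0 : ∀ {x y v} → (x , v) ≺₂ (y , 0) → x ℕ.< y
  ≺₂-0 (inj₁ x<y) = x<y

  -- Reversal puts n - y before n - x whatever the minor places are: arcs leaving the eastern
  -- cluster below, towards the same zone, are nested.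
  rev-≺₂ : ∀ {x y u v} → x ℕ.< y → y ℕ.< n → ¬ ((n ℕ.∸ x , u) ≺₂ (n ℕ.∸ y , v))
  rev-≺₂ x<y y<n (inj₁ p)       = ℕ.<-asym x<y (ℕ.∸-cancelʳ-< p)
  rev-≺₂ x<y y<n (inj₂ (e , _)) = ℕ.<-irrefl (≡.sym e) (rev-< (ℕ.<⇒≤ y<n) x<y)

  -- Equal major places mean a common eastern end, and then the minor places are ordered against x <
  -- x′: the arcs above are nested.
  rev-major : ∀ {x y x′ y′} → x ℕ.< x′ → (n ℕ.∸ y , n ℕ.∸ x) ≺₂ (n ℕ.∸ y′ , n ℕ.∸ x′) → y′ ℕ.< y
  rev-major x<x′ (inj₁ p)       = ℕ.∸-cancelʳ-< p
  rev-major x<x′ (inj₂ (_ , p)) = contradiction (ℕ.∸-cancelʳ-< p) (ℕ.<-asym x<x′)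

  -- For a common smaller index the reversed M would contradict M < M′, so edges sharing that end do
  -- not cross.
  alternate : ∀ {m M m′ M′} → (m , n ℕ.∸ M) ≺₂ (m′ , n ℕ.∸ M′) → M ℕ.< M′ → m ℕ.< m′
  alternate (inj₁ m<m′)    _    = m<m′
  alternate (inj₂ (_ , p)) M<M′ = contradiction (ℕ.∸-cancelʳ-< p) (ℕ.<-asym M<M′)

  -- Of the 32 combinations of a page and two kinds only six can interleave, one for each entry
  -- produced by the three code functions. In the others the zones exclude it, the arcs are nested,
  -- or a short arc has no vertex inside.
  crossing∈codes : ∀ p c c′ → Valid c → Valid c′ → loSpot p c ≺ loSpot p c′ → loSpot p c′ ≺ hiSpot p c →
                   hiSpot p c ≺ hiSpot p c′ → (p , c , c′) ∈ codes n
  crossing∈codes below (around , _) (around , _) _ (_ , M′<n , _) M≺M′ _ r = contradiction r (rev-≺₂ (≺₂-0 M≺M′) M′<n)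
  crossing∈codes below (around , _) (direct , _) _ _ () _ _
  crossing∈codes below (around , _) (inEast , _) _ _ _ _ ()
  crossing∈codes below (around , _) (inWest , _) _ _ () _ _
  crossing∈codes below (direct , _) (around , _) (m<M , M<n , p) (m′<M′ , _ , q) _ M′≺m _ =
    adjacent∈ n (∈-adjacent n m′<M′ (≺₂-0 M′≺m) m<M M<n q p) (here ≡.refl)
  crossing∈codes below (direct , _) (direct , _) _ (m′<M′ , M′<n , _) r _ m≺m′ =
    contradiction r (rev-≺₂ (≺₂-0 m≺m′) (ℕ.<-trans m′<M′ M′<n))
  crossing∈codes below (direct , _) (inEast , _) _ _ _ m′≺m m≺m′ = contradiction m≺m′ (sandwich m′≺m)
  crossing∈codes below (direct , _) (inWest , _) _ _ () _ _
  crossing∈codes below (inEast , _) (around , _) _ _ m≺M′ M′≺m _ = contradiction M′≺m (sandwich m≺M′)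
  crossing∈codes below (inEast , _) (direct , _) _ _ () _ _
  crossing∈codes below (inEast , _) (inEast , _) _ _ m≺m′ m′≺m _ = contradiction m′≺m (sandwich m≺m′)
  crossing∈codes below (inEast , _) (inWest , _) _ _ () _ _
  crossing∈codes below (inWest , _) (around , _) _ _ _ () _
  crossing∈codes below (inWest , _) (direct , _) _ _ _ () _
  crossing∈codes below (inWest , _) (inEast , _) _ _ _ () _
  crossing∈codes below (inWest , _) (inWest , _) (_ , _ , p) (_ , M′<n , q) m≺m′ m′≺M M≺M′ =
    alternating∈ n (∈-alternating n (alternate m≺m′ (≺₂-0 M≺M′)) (≺₂-0 m′≺M) (≺₂-0 M≺M′) M′<n p q) (there (here ≡.refl))
  crossing∈codes above (around , _) (around , _) (_ , M<n , p) (m′<M′ , _ , q) m≺m′ _ r =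
    nested∈ n (∈-nested n (≺₂-0 m≺m′) m′<M′ (rev-major (≺₂-0 m≺m′) r) M<n p q) (here ≡.refl)
  crossing∈codes above (around , _) (direct , _) _ _ _ _ ()
  crossing∈codes above (around , _) (inEast , _) _ _ _ _ ()
  crossing∈codes above (around , _) (inWest , _) _ _ _ _ ()
  crossing∈codes above (direct , _) (around , _) (m<M , _ , p) (m′<M′ , M′<n , q) M≺m′ _ _ =
    adjacent∈ n (∈-adjacent n m<M (≺₂-0 M≺m′) m′<M′ M′<n p q) (there (here ≡.refl))
  crossing∈codes above (direct , _) (direct , _) (m<M , _ , p) (_ , M′<n , q) M≺M′ _ r =
    nested∈ n (∈-nested n (rev-major (≺₂-0 M≺M′) r) m<M (≺₂-0 M≺M′) M′<n q p) (there (here ≡.refl))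
  crossing∈codes above (direct , _) (inEast , _) _ _ _ () _
  crossing∈codes above (direct , _) (inWest , _) _ _ _ _ ()
  crossing∈codes above (inEast , _) (around , _) _ _ () _ _
  crossing∈codes above (inEast , _) (direct , _) _ _ () _ _
  crossing∈codes above (inEast , _) (inEast , _) (_ , _ , p) (_ , M′<n , q) m≺m′ m′≺M M≺M′ =
    alternating∈ n (∈-alternating n (alternate m≺m′ (≺₂-0 M≺M′)) (≺₂-0 m′≺M) (≺₂-0 M≺M′) M′<n p q) (here ≡.refl)
  crossing∈codes above (inEast , _) (inWest , _) _ _ () _ _
  crossing∈codes above (inWest , _) (around , _) _ _ m≺m′ m′≺m _ = contradiction m′≺m (sandwich m≺m′)
  crossing∈codes above (inWest , _) (direct , _) _ _ m≺M′ M′≺m _ = contradiction M′≺m (sandwich m≺M′)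
  crossing∈codes above (inWest , _) (inEast , _) _ _ _ () _
  crossing∈codes above (inWest , _) (inWest , _) _ _ m≺m′ m′≺m _ = contradiction m′≺m (sandwich m≺m′)

-- The complete bipartite graph minus a perfect matching as a book.

tag : Parity → Parity → Bool → Tag
tag 0ℙ 1ℙ _     = inEast
tag 1ℙ 0ℙ _     = inWest
tag 0ℙ 0ℙ true  = direct
tag 0ℙ 0ℙ false = around
tag 1ℙ 1ℙ true  = around
tag 1ℙ 1ℙ false = direct

-- The arc starts at its a-end. An edge between the clusters meets its eastern end from below;
-- inside the eastern cluster the smaller end is joined below, inside the western one above.
startsBelow : Parity → Parity → Bool → Bool
startsBelow 0ℙ 0ℙ _   = true
startsBelow 1ℙ 1ℙ _   = false
startsBelow 0ℙ 1ℙ asc = asc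
startsBelow 1ℙ 0ℙ asc = not asc

-- The kind of an edge and the parity of its smaller index tell whether that index belongs to the
-- a-end. Hence a code determines its edge.
ascending : Tag → Parity → Bool
ascending around 0ℙ = false
ascending around 1ℙ = true
ascending direct 0ℙ = true
ascending direct 1ℙ = false
ascending inEast 0ℙ = true
ascending inEast 1ℙ = false
ascending inWest 0ℙ = false
ascending inWest 1ℙ = true

ascending-true : ∀ x y → ascending (tag x y true) x ≡ true
ascending-true 0ℙ 0ℙ = ≡.refl
ascending-true 0ℙ 1ℙ = ≡.refl
ascending-true 1ℙ 0ℙ = ≡.refl
ascending-true 1ℙ 1ℙ = ≡.refl

ascending-false : ∀ x y → ascending (tag x y false) y ≡ false
ascending-false 0ℙ 0ℙ = ≡.refl
ascending-false 0ℙ 1ℙ = ≡.refl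
ascending-false 1ℙ 0ℙ = ≡.refl
ascending-false 1ℙ 1ℙ = ≡.refl

-- Parities and decision are arguments so that `code-span` can split on them.
sortedCode : ∀ {k l} → Parity → Parity → Dec (k ℕ.< l) → Code
sortedCode {k} {l} x y (yes _) = tag x y true , k , l
sortedCode {k} {l} x y (no _)  = tag x y false , l , k

module KₙₙBook (n : ℕ) where
  open Layout n

  G : Graph
  G = Kₙₙ-nK₂ n

  code : KEdge n → Code
  code (edge i j _) = sortedCode (parity (toℕ i)) (parity (toℕ j)) (toℕ i ℕ.<? toℕ j)

  edge? : ℕ → ℕ → Maybe (KEdge n)
  edge? k l with k ℕ.<? n | l ℕ.<? n
  ... | no _    | _       = nothing
  ... | yes _   | no _    = nothing
  ... | yes k<n | yes l<n with fromℕ< k<n Fin.≟ fromℕ< l<n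
  ...   | yes _  = nothing
  ...   | no i≢j = just (edge (fromℕ< k<n) (fromℕ< l<n) i≢j)

  edge-cong : ∀ {i i′ j j′ : Fin n} .{p : i ≢ j} .{q : i′ ≢ j′} → i ≡ i′ → j ≡ j′ → edge i j p ≡ edge i′ j′ q
  edge-cong ≡.refl ≡.refl = ≡.refl

  edge?-toℕ : ∀ i j .(i≢j : i ≢ j) → edge? (toℕ i) (toℕ j) ≡ just (edge i j i≢j)
  edge?-toℕ i j i≢j with toℕ i ℕ.<? n | toℕ j ℕ.<? n
  ... | no ¬p | _     = contradiction (Fin.toℕ<n i) ¬p
  ... | yes _ | no ¬q = contradiction (Fin.toℕ<n j) ¬q
  ... | yes p | yes q with fromℕ< p Fin.≟ fromℕ< q
  ...   | yes e = ⊥-elim-irr (i≢j (≡.trans (≡.sym (Fin.fromℕ<-toℕ i p)) (≡.trans e (Fin.fromℕ<-toℕ j q))))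
  ...   | no _  = ≡.cong just (edge-cong (Fin.fromℕ<-toℕ i p) (Fin.fromℕ<-toℕ j q))

  decode : Code → Maybe (KEdge n)
  decode (t , m , M) = if ascending t (parity m) then edge? m M else edge? M m

  decode-code : ∀ e → decode (code e) ≡ just e
  decode-code (edge i j i≢j) with toℕ i ℕ.<? toℕ j
  ... | yes _ rewrite ascending-true (parity (toℕ i)) (parity (toℕ j)) = edge?-toℕ i j i≢j
  ... | no _ rewrite ascending-false (parity (toℕ i)) (parity (toℕ j)) = edge?-toℕ i j i≢j

  code-injective : Injective _≡_ _≡_ code
  code-injective {e} {f} p =
    Maybe.just-injective (≡.trans (≡.sym (decode-code e)) (≡.trans (≡.cong decode p) (decode-code f)))

  related-true : ∀ x y → Related (tag x y true) x y
  related-true 0ℙ 0ℙ = ≡.refl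
  related-true 0ℙ 1ℙ = ≡.refl
  related-true 1ℙ 0ℙ = ≡.refl
  related-true 1ℙ 1ℙ = ≡.refl

  related-false : ∀ x y → Related (tag x y false) y x
  related-false 0ℙ 0ℙ = ≡.refl
  related-false 0ℙ 1ℙ = ≡.refl
  related-false 1ℙ 0ℙ = ≡.refl
  related-false 1ℙ 1ℙ = ≡.refl

  code-valid : ∀ e → Valid (code e)
  code-valid (edge i j i≢j) with toℕ i ℕ.<? toℕ j
  ... | yes i<j = i<j , Fin.toℕ<n j , related-true (parity (toℕ i)) (parity (toℕ j))
  ... | no  i≮j = ℕ.≤∧≢⇒< (ℕ.≮⇒≥ i≮j) (λ j≡i → ⊥-elim-irr (i≢j (Fin.toℕ-injective (≡.sym j≡i))))
                , Fin.toℕ<n i , related-false (parity (toℕ i)) (parity (toℕ j))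

  spotA spotB : Parity → ℕ → Spot
  spotA 0ℙ = east
  spotA 1ℙ = west
  spotB 0ℙ = west
  spotB 1ℙ = east

  spot : KVertex n → Spot
  spot (a i) = spotA (parity (toℕ i)) (toℕ i)
  spot (b j) = spotB (parity (toℕ j)) (toℕ j)

  data OnSite (k : ℕ) : Spot → Set where
    isEast : OnSite k (east k)
    isWest : OnSite k (west k)

  onSiteA : ∀ x k → OnSite k (spotA x k)
  onSiteA 0ℙ k = isEast
  onSiteA 1ℙ k = isWest

  onSiteB : ∀ x k → OnSite k (spotB x k)
  onSiteB 0ℙ k = isWest
  onSiteB 1ℙ k = isEast

  site : ∀ v → ∃[ i ] OnSite (toℕ {n} i) (spot v)
  site (a i) = i , onSiteA (parity (toℕ i)) (toℕ i)
  site (b j) = j , onSiteB (parity (toℕ j)) (toℕ j)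

  onSite-small : ∀ (i : Fin n) {s} → OnSite (toℕ i) s → Small s
  onSite-small i isEast = ℕ.<⇒≤ (Fin.toℕ<n i) , ℕ.z≤n
  onSite-small i isWest = ℕ.<⇒≤ (Fin.toℕ<n i) , ℕ.z≤n

  onSite-unique : ∀ {k l s} → OnSite k s → OnSite l s → k ≡ l
  onSite-unique isEast isEast = ≡.refl
  onSite-unique isWest isWest = ≡.refl

  spot-small : ∀ v → Small (spot v)
  spot-small v = let i , on = site v in onSite-small i on

  spotA≢spotB : ∀ x k → spotA x k ≢ spotB x k
  spotA≢spotB 0ℙ k ()
  spotA≢spotB 1ℙ k ()

  spot-injective : ∀ v w → spot v ≡ spot w → v ≡ w
  spot-injective (a i) (a j) e = ≡.cong a (Fin.toℕ-injective (onSite-unique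
    (onSiteA (parity (toℕ i)) (toℕ i)) (≡.subst (OnSite (toℕ j)) (≡.sym e) (onSiteA (parity (toℕ j)) (toℕ j)))))
  spot-injective (b i) (b j) e = ≡.cong b (Fin.toℕ-injective (onSite-unique
    (onSiteB (parity (toℕ i)) (toℕ i)) (≡.subst (OnSite (toℕ j)) (≡.sym e) (onSiteB (parity (toℕ j)) (toℕ j)))))
  spot-injective (a i) (b j) e = contradiction (≡.trans e (≡.cong (λ k → spotB (parity k) k) (≡.sym i≡j)))
    (spotA≢spotB (parity (toℕ i)) (toℕ i))
    where
    i≡j = onSite-unique (onSiteA (parity (toℕ i)) (toℕ i))
            (≡.subst (OnSite (toℕ j)) (≡.sym e) (onSiteB (parity (toℕ j)) (toℕ j)))
  spot-injective (b i) (a j) e = contradiction (≡.trans (≡.sym e) (≡.cong (λ k → spotB (parity k) k) i≡j))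
    (spotA≢spotB (parity (toℕ j)) (toℕ j))
    where
    i≡j = onSite-unique (onSiteB (parity (toℕ i)) (toℕ i))
            (≡.subst (OnSite (toℕ j)) (≡.sym e) (onSiteA (parity (toℕ j)) (toℕ j)))

  midSpot-injective : ∀ {c c′} → Valid c → Valid c′ → midSpot c ≡ midSpot c′ → c ≡ c′
  midSpot-injective {t , m , M} {t′ , m′ , M′} (m<M , M<n , _) (m′<M′ , M′<n , _) = go t t′
    where
    rev : ∀ {x y} → x ℕ.< n → y ℕ.< n → n ℕ.∸ x ≡ n ℕ.∸ y → x ≡ y
    rev x<n y<n = ℕ.∸-cancelˡ-≡ (ℕ.<⇒≤ x<n) (ℕ.<⇒≤ y<n)

    rev-M : n ℕ.∸ M ≡ n ℕ.∸ M′ → M ≡ M′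
    rev-M = rev M<n M′<n

    rev-m : n ℕ.∸ m ≡ n ℕ.∸ m′ → m ≡ m′
    rev-m = rev (ℕ.<-trans m<M M<n) (ℕ.<-trans m′<M′ M′<n)

    second : ∀ {s t : Spot} → s ≡ t → proj₁ (proj₂ s) ≡ proj₁ (proj₂ t)
    second = ≡.cong (λ s → proj₁ (proj₂ s))

    third : ∀ {s t : Spot} → s ≡ t → proj₂ (proj₂ s) ≡ proj₂ (proj₂ t)
    third = ≡.cong (λ s → proj₂ (proj₂ s))

    go : ∀ t t′ → midSpot (t , m , M) ≡ midSpot (t′ , m′ , M′) → (t , m , M) ≡ (t′ , m′ , M′)
    go around around e = ≡.cong₂ (λ m M → around , m , M) (rev-m (third e)) (rev-M (second e))
    go direct direct e = ≡.cong₂ (λ m M → direct , m , M) (rev-m (second e)) (rev-M (third e))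
    go inEast inEast e = ≡.cong₂ (λ m M → inEast , m , M) (second e) (rev-M (third e))
    go inWest inWest e = ≡.cong₂ (λ m M → inWest , m , M) (second e) (rev-M (third e))
    go around direct ()
    go around inEast ()
    go around inWest ()
    go direct around ()
    go direct inEast ()
    go direct inWest ()
    go inEast around ()
    go inEast direct ()
    go inEast inWest ()
    go inWest around ()
    go inWest direct ()
    go inWest inEast ()

  -- In a cluster the last component is n - M > 0 at a subdivision point and 0 at a vertex; the
  -- other two zones contain no vertices.
  midSpot≢site : ∀ c {k s} → Valid c → OnSite k s → midSpot c ≢ s
  midSpot≢site (inWest , m , M) (_ , M<n , _) isWest e =
    contradiction (≡.cong (λ s → proj₂ (proj₂ s)) e) (ℕ.>⇒≢ (ℕ.m<n⇒0<n∸m M<n))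
  midSpot≢site (inEast , m , M) (_ , M<n , _) isEast e =
    contradiction (≡.cong (λ s → proj₂ (proj₂ s)) e) (ℕ.>⇒≢ (ℕ.m<n⇒0<n∸m M<n))
  midSpot≢site (inWest , _) _ isEast ()
  midSpot≢site (inEast , _) _ isWest ()
  midSpot≢site (around , _) _ isEast ()
  midSpot≢site (around , _) _ isWest ()
  midSpot≢site (direct , _) _ isEast ()
  midSpot≢site (direct , _) _ isWest ()

  lo≺hi : ∀ p c → Valid c → loSpot p c ≺ hiSpot p c
  lo≺hi below (around , _) _             = tt
  lo≺hi below (direct , _) _             = tt
  lo≺hi below (inEast , _) (_ , M<n , _) = inj₂ (≡.refl , ℕ.m<n⇒0<n∸m M<n)
  lo≺hi below (inWest , _) (m<M , _)     = inj₁ m<M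
  lo≺hi above (around , _) _             = tt
  lo≺hi above (direct , _) _             = tt
  lo≺hi above (inEast , _) (m<M , _)     = inj₁ m<M
  lo≺hi above (inWest , _) (_ , M<n , _) = inj₂ (≡.refl , ℕ.m<n⇒0<n∸m M<n)

  endSpot : Parity → Parity → ℕ → ℕ → Bool → Spot
  endSpot x y k l true  = spotA x k
  endSpot x y k l false = spotB y l

  code-span : ∀ p x y {k l} (d : Dec (k ℕ.< l)) → let c = sortedCode x y d in Valid c →
              Span (rank (midSpot c)) (rank (endSpot x y k l (firstOn p (startsBelow x y (does d)))))
                   (rank (loSpot p c)) (rank (hiSpot p c))
  code-span p x y d v = go p x y d
    (rank-mono {loSpot p (sortedCode x y d)} {hiSpot p (sortedCode x y d)} (small-lo p _ v) (lo≺hi p _ v))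
    where
    go : ∀ p x y {k l} (d : Dec (k ℕ.< l)) → let c = sortedCode x y d in rank (loSpot p c) ℕ.< rank (hiSpot p c) →
         Span (rank (midSpot c)) (rank (endSpot x y k l (firstOn p (startsBelow x y (does d)))))
              (rank (loSpot p c)) (rank (hiSpot p c))
    go below 0ℙ 0ℙ (yes _) lt = fwd lt
    go below 0ℙ 0ℙ (no _)  lt = bwd lt
    go below 1ℙ 1ℙ (yes _) lt = bwd lt
    go below 1ℙ 1ℙ (no _)  lt = fwd lt
    go below 0ℙ 1ℙ (yes _) lt = bwd lt
    go below 0ℙ 1ℙ (no _)  lt = bwd lt
    go below 1ℙ 0ℙ (yes _) lt = fwd lt
    go below 1ℙ 0ℙ (no _)  lt = fwd lt
    go above 0ℙ 0ℙ (yes _) lt = bwd lt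
    go above 0ℙ 0ℙ (no _)  lt = bwd lt
    go above 1ℙ 1ℙ (yes _) lt = bwd lt
    go above 1ℙ 1ℙ (no _)  lt = bwd lt
    go above 0ℙ 1ℙ (yes _) lt = fwd lt
    go above 0ℙ 1ℙ (no _)  lt = fwd lt
    go above 1ℙ 0ℙ (yes _) lt = bwd lt
    go above 1ℙ 0ℙ (no _)  lt = bwd lt

  _≟ₑ_ : DecidableEquality (KEdge n)
  edge i j _ ≟ₑ edge i′ j′ _ with i Fin.≟ i′ | j Fin.≟ j′
  ... | yes i≡i′ | yes j≡j′ = yes (edge-cong i≡i′ j≡j′)
  ... | no  i≢i′ | _        = no λ { ≡.refl → i≢i′ ≡.refl }
  ... | yes _    | no  j≢j′ = no λ { ≡.refl → j≢j′ ≡.refl }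

  starts : KEdge n → Bool
  starts (edge i j _) = startsBelow (parity (toℕ i)) (parity (toℕ j)) (does (toℕ i ℕ.<? toℕ j))

  end-spot : ∀ s (i j : Fin n) .(i≢j : i ≢ j) →
             endSpot (parity (toℕ i)) (parity (toℕ j)) (toℕ i) (toℕ j) s ≡ spot (end G s (edge i j i≢j))
  end-spot true  _ _ _ = ≡.refl
  end-spot false _ _ _ = ≡.refl

  edge-span : ∀ p e → Span (rank (midSpot (code e))) (rank (spot (end G (firstOn p (starts e)) e)))
                           (rank (loSpot p (code e))) (rank (hiSpot p (code e)))
  edge-span p e@(edge i j i≢j) =
    ≡.subst (λ s → Span (rank (midSpot (code e))) (rank s) (rank (loSpot p (code e))) (rank (hiSpot p (code e))))
      (end-spot (firstOn p (starts e)) i j i≢j)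
      (code-span p (parity (toℕ i)) (parity (toℕ j)) (toℕ i ℕ.<? toℕ j) (code-valid e))

  book : Book G
  book = record
    { _≟ₑ_          = _≟ₑ_
    ; pos           = λ v → rank (spot v)
    ; pos-injective = λ {v} {w} e → spot-injective v w (rank-injective (spot-small v) (spot-small w) e)
    ; mid           = λ e → rank (midSpot (code e))
    ; mid-injective = λ {e} {f} p → code-injective (midSpot-injective (code-valid e) (code-valid f)
        (rank-injective (small-mid (code e) (code-valid e)) (small-mid (code f) (code-valid f)) p))
    ; mid≢pos       = λ e v p → midSpot≢site (code e) (code-valid e) (proj₂ (site v))
        (rank-injective (small-mid (code e) (code-valid e)) (spot-small v) p)
    ; startsBelow   = starts
    ; lo            = λ p e → rank (loSpot p (code e))
    ; hi            = λ p e → rank (hiSpot p (code e))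
    ; span          = edge-span
    }

  codes-complete : ∀ p e f → Book.Interleave book p e f → (p , code e , code f) ∈ codes n
  codes-complete p e f (l<l′ , l′<h , h<h′) = crossing∈codes p (code e) (code f) ve vf
    (rank-cancel {loSpot p (code e)} {loSpot p (code f)} (small-lo p (code f) vf) l<l′)
    (rank-cancel {loSpot p (code f)} {hiSpot p (code e)} (small-hi p (code e) ve) l′<h)
    (rank-cancel {hiSpot p (code e)} {hiSpot p (code f)} (small-hi p (code f) vf) h<h′)
    where
    ve = code-valid e
    vf = code-valid f

crossingNumber≤codes : ∀ ℝ n → CrossingNumberAtMost ℝ (Kₙₙ-nK₂ n) (length (codes n))
crossingNumber≤codes ℝ n = crossingNumber≤
  where
  open KₙₙBook n
  open BookDrawing ℝ book
  open Bound code decode decode-code (codes n) codes-complete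

-- Counting chains by parity word.

open import Data.Nat.Base using (_+_; _*_; _∸_; _≥_; _≤_; ⌊_/2⌋)

twice : ℕ → ℕ
twice zero    = zero
twice (suc k) = suc (suc (twice k))

parity-twice : ∀ k → parity (twice k) ≡ 0ℙ
parity-twice zero    = ≡.refl
parity-twice (suc k) = parity-twice k

parity-1+twice : ∀ k → parity (suc (twice k)) ≡ 1ℙ
parity-1+twice zero    = ≡.refl
parity-1+twice (suc k) = parity-1+twice k

half-twice : ∀ k → ⌊ twice k /2⌋ ≡ k
half-twice zero    = ≡.refl
half-twice (suc k) = ≡.cong suc (half-twice k)

half-1+twice : ∀ k → ⌊ suc (twice k) /2⌋ ≡ k
half-1+twice zero    = ≡.refl
half-1+twice (suc k) = ≡.cong suc (half-1+twice k)

data Halved : ℕ → Set where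
  even : ∀ k → Halved (twice k)
  odd  : ∀ k → Halved (suc (twice k))

halved : ∀ n → Halved n
halved zero    = even zero
halved (suc n) with halved n
... | even k = odd k
... | odd k  = even (suc k)

count : List Parity → ℕ → ℕ
count w n = length (chains w n)

count-hit : ∀ n {p} w → parity n ≡ p → count (p ∷ w) (suc n) ≡ count (p ∷ w) n + count w n
count-hit n w ≡.refl = ≡.trans (List.length-++ (chains (parity n ∷ w) n))
  (≡.cong (count (parity n ∷ w) n +_)
    (≡.trans (≡.cong length (keep-refl (parity n) (map (n ∷_) (chains w n)))) (List.length-map (n ∷_) (chains w n))))

keep-⁻¹ : {A : Set} (p : Parity) (xs : List A) → keep (p ⁻¹) p xs ≡ []
keep-⁻¹ 0ℙ _ = ≡.refl
keep-⁻¹ 1ℙ _ = ≡.refl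

count-miss : ∀ n {p} w → parity n ≡ p ⁻¹ → count (p ∷ w) (suc n) ≡ count (p ∷ w) n
count-miss n {p} w e rewrite e | keep-⁻¹ p (map (n ∷_) (chains w n)) =
  ≡.cong length (List.++-identityʳ (chains (p ∷ w) n))

E O : List Parity → ℕ → ℕ
E w k = count w (twice k)
O w k = count w (suc (twice k))

-- Passing from 2k to 2k + 1 admits 2k as a new largest member, passing on to 2k + 2 admits 2k + 1;
-- a word reacts only to the step of its first parity.
O-0 : ∀ w k → O (0ℙ ∷ w) k ≡ E (0ℙ ∷ w) k + E w k
O-0 w k = count-hit (twice k) w (parity-twice k)

O-1 : ∀ w k → O (1ℙ ∷ w) k ≡ E (1ℙ ∷ w) k
O-1 w k = count-miss (twice k) w (parity-twice k)

E-0 : ∀ w k → E (0ℙ ∷ w) (suc k) ≡ E (0ℙ ∷ w) k + E w k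
E-0 w k = ≡.trans (count-miss (suc (twice k)) w (parity-1+twice k)) (O-0 w k)

E-1 : ∀ w k → E (1ℙ ∷ w) (suc k) ≡ E (1ℙ ∷ w) k + O w k
E-1 w k = ≡.trans (count-hit (suc (twice k)) w (parity-1+twice k)) (≡.cong (_+ O w k) (O-1 w k))

-- Words are read from the largest member of a chain down.
[0] [1] [00] [01] [10] [11] : List Parity
[0]  = 0ℙ ∷ []
[1]  = 1ℙ ∷ []
[00] = 0ℙ ∷ [0]
[01] = 0ℙ ∷ [1]
[10] = 1ℙ ∷ [0]
[11] = 1ℙ ∷ [1]

E[0] : ∀ k → E [0] k ≡ k
E[0] zero    = ≡.refl
E[0] (suc k) = ≡.trans (E-0 [] k) (≡.trans (≡.cong (_+ 1) (E[0] k)) (ℕ.+-comm k 1))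

E[1] : ∀ k → E [1] k ≡ k
E[1] zero    = ≡.refl
E[1] (suc k) = ≡.trans (E-1 [] k) (≡.trans (≡.cong (_+ 1) (E[1] k)) (ℕ.+-comm k 1))

O[0] : ∀ k → O [0] k ≡ suc k
O[0] k = ≡.trans (O-0 [] k) (≡.trans (≡.cong (_+ 1) (E[0] k)) (ℕ.+-comm k 1))

O[1] : ∀ k → O [1] k ≡ k
O[1] k = ≡.trans (O-1 [] k) (E[1] k)

-- f k is 0 + 1 + ... + (k - 1); doubling it and adding k avoids both division and subtraction.
triangular : ∀ {f : ℕ → ℕ} → f 0 ≡ 0 → (∀ k → f (suc k) ≡ f k + k) → ∀ k → 2 * f k + k ≡ k * k
triangular     f0 fs zero    = ≡.trans (ℕ.+-identityʳ _) (≡.cong (2 *_) f0)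
triangular {f} f0 fs (suc k) = begin
  2 * f (suc k) + suc k        ≡⟨ ≡.cong (λ x → 2 * x + suc k) (fs k) ⟩
  2 * (f k + k) + suc k        ≡⟨ regroup (f k) k ⟩
  2 * f k + k + (2 * k + 1)    ≡⟨ ≡.cong (_+ (2 * k + 1)) (triangular {f} f0 fs k) ⟩
  k * k + (2 * k + 1)          ≡⟨ square k ⟩
  suc k * suc k                ∎
  where
  open ≡-Reasoning
  regroup : ∀ x k → 2 * (x + k) + suc k ≡ 2 * x + k + (2 * k + 1)
  regroup = solve-∀
  square : ∀ k → k * k + (2 * k + 1) ≡ suc k * suc k
  square = solve-∀

E[00] : ∀ k → 2 * E [00] k + k ≡ k * k
E[00] = triangular {E [00]} ≡.refl (λ k → ≡.trans (E-0 [0] k) (≡.cong (E [00] k +_) (E[0] k)))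

E[01] : ∀ k → 2 * E [01] k + k ≡ k * k
E[01] = triangular {E [01]} ≡.refl (λ k → ≡.trans (E-0 [1] k) (≡.cong (E [01] k +_) (E[1] k)))

E[11] : ∀ k → 2 * E [11] k + k ≡ k * k
E[11] = triangular {E [11]} ≡.refl (λ k → ≡.trans (E-1 [1] k) (≡.cong (E [11] k +_) (O[1] k)))

-- An odd 2a + 1 exceeds an even 2b already for b ≤ a, so unlike in the other three words the
-- diagonal is included, giving k (k + 1) / 2.
E[10] : ∀ k → 2 * E [10] k ≡ k * k + k
E[10] zero    = ≡.refl
E[10] (suc k) = begin
  2 * E [10] (suc k)           ≡⟨ ≡.cong (2 *_) (≡.trans (E-1 [0] k) (≡.cong (E [10] k +_) (O[0] k))) ⟩
  2 * (E [10] k + suc k)       ≡⟨ ℕ.*-distribˡ-+ 2 (E [10] k) (suc k) ⟩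
  2 * E [10] k + 2 * suc k     ≡⟨ ≡.cong (_+ 2 * suc k) (E[10] k) ⟩
  k * k + k + 2 * suc k        ≡⟨ expand k ⟩
  suc k * suc k + suc k        ∎
  where
  open ≡-Reasoning
  expand : ∀ k → k * k + k + 2 * suc k ≡ suc k * suc k + suc k
  expand = solve-∀

-- Q sums over the six admissible parity words, T₀ and T₁ over what remains of them when an
-- even or an odd largest member is removed.
T₀ T₁ Q : (List Parity → ℕ) → ℕ
T₀ f = f (0ℙ ∷ [00]) + f (0ℙ ∷ [11]) + f (1ℙ ∷ [10])
T₁ f = f (0ℙ ∷ [01]) + f (1ℙ ∷ [00]) + f (1ℙ ∷ [11])
Q  f = f (0ℙ ∷ 0ℙ ∷ [00]) + f (0ℙ ∷ 0ℙ ∷ [11]) + f (0ℙ ∷ 1ℙ ∷ [10])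
     + (f (1ℙ ∷ 0ℙ ∷ [01]) + f (1ℙ ∷ 1ℙ ∷ [00]) + f (1ℙ ∷ 1ℙ ∷ [11]))

T₀-suc : ∀ k → T₀ (λ w → E w (suc k)) ≡ T₀ (λ w → E w k) + (E [00] k + E [11] k + E [10] k)
T₀-suc k rewrite E-0 [00] k | E-0 [11] k | E-1 [10] k | O-1 [0] k = regroup (E (0ℙ ∷ [00]) k) _ _ _ _ _
  where
  regroup : ∀ x y z u v w → (x + u) + (y + v) + (z + w) ≡ (x + y + z) + (u + v + w)
  regroup = solve-∀

-- The additional k comes from the word 100: beneath 2k + 1 the even pair may contain 2k, with any
-- of the k smaller even numbers.
T₁-suc : ∀ k → T₁ (λ w → E w (suc k)) ≡ T₁ (λ w → E w k) + (E [01] k + (E [00] k + k) + E [11] k)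
T₁-suc k rewrite E-0 [01] k | E-1 [00] k | E-1 [11] k | O-0 [0] k | O-1 [1] k | E[0] k =
  regroup (E (0ℙ ∷ [01]) k) _ _ _ _ _
  where
  regroup : ∀ x y z u v w → (x + u) + (y + v) + (z + w) ≡ (x + y + z) + (u + v + w)
  regroup = solve-∀

-- The largest member 2k leaves a word of `T₀` below 2k. The largest member 2k + 1 leaves a word of
-- `T₁` below 2k + 1; such a triple contains 2k only for the word 001, whose remainder 01 is counted
-- by `E [01] k`.
Q-even : ∀ k → Q (λ w → E w (suc k)) ≡ Q (λ w → E w k) + (T₀ (λ w → E w k) + (T₁ (λ w → E w k) + E [01] k))
Q-even k rewrite E-0 (0ℙ ∷ [00]) k | E-0 (0ℙ ∷ [11]) k | E-0 (1ℙ ∷ [10]) k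
  | E-1 (0ℙ ∷ [01]) k | E-1 (1ℙ ∷ [00]) k | E-1 (1ℙ ∷ [11]) k | O-0 [01] k | O-1 [00] k | O-1 [11] k =
  regroup (E (0ℙ ∷ 0ℙ ∷ [00]) k) _ _ (E (1ℙ ∷ 0ℙ ∷ [01]) k) (E (1ℙ ∷ 1ℙ ∷ [00]) k) _ _ _ _
    (E (0ℙ ∷ [01]) k) (E (1ℙ ∷ [00]) k) _ (E [01] k)
  where
  regroup : ∀ x₁ x₂ x₃ y₁ y₂ y₃ u₁ u₂ u₃ v₁ v₂ v₃ z →
    (x₁ + u₁) + (x₂ + u₂) + (x₃ + u₃) + ((y₁ + (v₁ + z)) + (y₂ + v₂) + (y₃ + v₃))
    ≡ (x₁ + x₂ + x₃ + (y₁ + y₂ + y₃)) + ((u₁ + u₂ + u₃) + ((v₁ + v₂ + v₃) + z))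
  regroup = solve-∀

Q-odd : ∀ k → Q (λ w → O w k) ≡ Q (λ w → E w k) + T₀ (λ w → E w k)
Q-odd k rewrite O-0 (0ℙ ∷ [00]) k | O-0 (0ℙ ∷ [11]) k | O-0 (1ℙ ∷ [10]) k
  | O-1 (0ℙ ∷ [01]) k | O-1 (1ℙ ∷ [00]) k | O-1 (1ℙ ∷ [11]) k =
  regroup (E (0ℙ ∷ 0ℙ ∷ [00]) k) _ _ _ _ _ _
  where
  regroup : ∀ x₁ x₂ x₃ y u₁ u₂ u₃ →
    (x₁ + u₁) + (x₂ + u₂) + (x₃ + u₃) + y ≡ (x₁ + x₂ + x₃ + y) + (u₁ + u₂ + u₃)
  regroup = solve-∀

-- 2 T(k) = k (k - 1)², as 2 T(k + 1) = 2 T(k) + 3 k² - k.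
T-closed : ∀ {T : ℕ → ℕ} → T 1 ≡ 0 → (∀ k → 2 * T (suc k) + k ≡ 2 * T k + 3 * (k * k)) →
           ∀ k → 2 * T (suc k) ≡ suc k * (k * k)
T-closed     T1 Ts zero    = ≡.cong (2 *_) T1
-- The recursion carries its negative term on the left, so the equation is proved after adding that
-- term to both sides.
T-closed {T} T1 Ts (suc k) = ℕ.+-cancelʳ-≡ (suc k) _ _ (begin
  2 * T (suc (suc k)) + suc k                   ≡⟨ Ts (suc k) ⟩
  2 * T (suc k) + 3 * (suc k * suc k)           ≡⟨ ≡.cong (_+ 3 * (suc k * suc k)) (T-closed {T} T1 Ts k) ⟩
  suc k * (k * k) + 3 * (suc k * suc k)         ≡⟨ expand k ⟩
  suc (suc k) * (suc k * suc k) + suc k         ∎)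
  where
  open ≡-Reasoning
  expand : ∀ k → suc k * (k * k) + 3 * (suc k * suc k) ≡ suc (suc k) * (suc k * suc k) + suc k
  expand = solve-∀

T₀-closed : ∀ k → 2 * T₀ (λ w → E w (suc k)) ≡ suc k * (k * k)
T₀-closed = T-closed {λ k → T₀ (λ w → E w k)} ≡.refl λ k → let t = T₀ (λ w → E w k) in begin
  2 * T₀ (λ w → E w (suc k)) + k                                  ≡⟨ ≡.cong (λ x → 2 * x + k) (T₀-suc k) ⟩
  2 * (t + (E [00] k + E [11] k + E [10] k)) + k                   ≡⟨ regroup t (E [00] k) (E [11] k) (E [10] k) k ⟩
  2 * t + ((2 * E [00] k + k) + 2 * E [11] k + 2 * E [10] k)       ≡⟨ ≡.cong₂ (λ x y → 2 * t + (x + 2 * E [11] k + y)) (E[00] k) (E[10] k) ⟩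
  2 * t + (k * k + 2 * E [11] k + (k * k + k))                     ≡⟨ regroup′ (2 * t) (k * k) (2 * E [11] k) k ⟩
  2 * t + (k * k + (2 * E [11] k + k) + k * k)                     ≡⟨ ≡.cong (λ x → 2 * t + (k * k + x + k * k)) (E[11] k) ⟩
  2 * t + (k * k + k * k + k * k)                                  ≡⟨ three (2 * t) (k * k) ⟩
  2 * t + 3 * (k * k)                                              ∎
  where
  open ≡-Reasoning
  regroup : ∀ t x y z k → 2 * (t + (x + y + z)) + k ≡ 2 * t + ((2 * x + k) + 2 * y + 2 * z)
  regroup = solve-∀
  regroup′ : ∀ t s y k → t + (s + y + (s + k)) ≡ t + (s + (y + k) + s)
  regroup′ = solve-∀
  three : ∀ t s → t + (s + s + s) ≡ t + 3 * s
  three = solve-∀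

T₁-closed : ∀ k → 2 * T₁ (λ w → E w (suc k)) ≡ suc k * (k * k)
T₁-closed = T-closed {λ k → T₁ (λ w → E w k)} ≡.refl λ k → let t = T₁ (λ w → E w k) in begin
  2 * T₁ (λ w → E w (suc k)) + k                                   ≡⟨ ≡.cong (λ x → 2 * x + k) (T₁-suc k) ⟩
  2 * (t + (E [01] k + (E [00] k + k) + E [11] k)) + k             ≡⟨ regroup t (E [01] k) (E [00] k) (E [11] k) k ⟩
  2 * t + ((2 * E [01] k + k) + (2 * E [00] k + k) + (2 * E [11] k + k))
    ≡⟨ ≡.cong₂ (λ x y → 2 * t + (x + y + (2 * E [11] k + k))) (E[01] k) (E[00] k) ⟩
  2 * t + (k * k + k * k + (2 * E [11] k + k))                     ≡⟨ ≡.cong (λ x → 2 * t + (k * k + k * k + x)) (E[11] k) ⟩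
  2 * t + (k * k + k * k + k * k)                                  ≡⟨ three (2 * t) (k * k) ⟩
  2 * t + 3 * (k * k)                                              ∎
  where
  open ≡-Reasoning
  regroup : ∀ t x y z k → 2 * (t + (x + (y + k) + z)) + k ≡ 2 * t + ((2 * x + k) + (2 * y + k) + (2 * z + k))
  regroup = solve-∀
  three : ∀ t s → t + (s + s + s) ≡ t + 3 * s
  three = solve-∀

-- With m = k + 2 the value is m (m - 1)² (m - 2); starting at m = 2 avoids truncated subtraction.
-- In the step from m to m + 1, adding 2 m completes 4 `E [01] m` to 2 m².
Q-even-closed : ∀ k → 4 * Q (λ w → E w (suc (suc k))) ≡ suc (suc k) * suc k * suc k * k
Q-even-closed zero    = ≡.refl
Q-even-closed (suc k) = ℕ.+-cancelʳ-≡ (2 * suc (suc k)) _ _ (begin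
  4 * Q (λ w → E w (suc (suc (suc k)))) + 2 * suc (suc k)
    ≡⟨ ≡.cong (λ x → 4 * x + 2 * suc (suc k)) (Q-even (suc (suc k))) ⟩
  4 * (q + (t₀ + (t₁ + e))) + 2 * suc (suc k)
    ≡⟨ regroup q t₀ t₁ e (suc (suc k)) ⟩
  4 * q + (2 * (2 * t₀) + (2 * (2 * t₁) + 2 * (2 * e + suc (suc k))))
    ≡⟨ ≡.cong₂ (λ x y → x + (2 * (2 * t₀) + (2 * (2 * t₁) + 2 * y))) (Q-even-closed k) (E[01] (suc (suc k))) ⟩
  q′ + (2 * (2 * t₀) + (2 * (2 * t₁) + 2 * (suc (suc k) * suc (suc k))))
    ≡⟨ ≡.cong₂ (λ x y → q′ + (2 * x + (2 * y + 2 * (suc (suc k) * suc (suc k))))) (T₀-closed (suc k)) (T₁-closed (suc k)) ⟩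
  q′ + (2 * (suc (suc k) * (suc k * suc k)) + (2 * (suc (suc k) * (suc k * suc k)) + 2 * (suc (suc k) * suc (suc k))))
    ≡⟨ expand k ⟩
  suc (suc (suc k)) * suc (suc k) * suc (suc k) * suc k + 2 * suc (suc k)
    ∎)
  where
  open ≡-Reasoning
  q  = Q (λ w → E w (suc (suc k)))
  q′ = suc (suc k) * suc k * suc k * k
  t₀ = T₀ (λ w → E w (suc (suc k)))
  t₁ = T₁ (λ w → E w (suc (suc k)))
  e  = E [01] (suc (suc k))
  regroup : ∀ q t u e k → 4 * (q + (t + (u + e))) + 2 * k ≡ 4 * q + (2 * (2 * t) + (2 * (2 * u) + 2 * (2 * e + k)))
  regroup = solve-∀
  expand : ∀ k → suc (suc k) * suc k * suc k * k + (2 * (suc (suc k) * (suc k * suc k))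
                   + (2 * (suc (suc k) * (suc k * suc k)) + 2 * (suc (suc k) * suc (suc k))))
                 ≡ suc (suc (suc k)) * suc (suc k) * suc (suc k) * suc k + 2 * suc (suc k)
  expand = solve-∀

Q-odd-closed : ∀ k → 4 * Q (λ w → O w (suc k)) ≡ suc k * suc k * k * k
Q-odd-closed zero    = ≡.refl
Q-odd-closed (suc k) = begin
  4 * Q (λ w → O w (suc (suc k)))                        ≡⟨ ≡.cong (4 *_) (Q-odd (suc (suc k))) ⟩
  4 * (q + t₀)                                           ≡⟨ regroup q t₀ ⟩
  4 * q + 2 * (2 * t₀)                                   ≡⟨ ≡.cong₂ (λ x y → x + 2 * y) (Q-even-closed k) (T₀-closed (suc k)) ⟩
  suc (suc k) * suc k * suc k * k + 2 * (suc (suc k) * (suc k * suc k)) ≡⟨ expand k ⟩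
  suc (suc k) * suc (suc k) * suc k * suc k              ∎
  where
  open ≡-Reasoning
  q  = Q (λ w → E w (suc (suc k)))
  t₀ = T₀ (λ w → E w (suc (suc k)))
  regroup : ∀ q t → 4 * (q + t) ≡ 4 * q + 2 * (2 * t)
  regroup = solve-∀
  expand : ∀ k → suc (suc k) * suc k * suc k * k + 2 * (suc (suc k) * (suc k * suc k))
                 ≡ suc (suc k) * suc (suc k) * suc k * suc k
  expand = solve-∀

-- The length of the list of codes, compared with the bound.

length-concatMap≤ : ∀ {A B : Set} {f : A → List B} {c} → (∀ x → length (f x) ≤ c) →
                    ∀ xs → length (concatMap f xs) ≤ c * length xs
length-concatMap≤ {c = c} f≤ [] = ℕ.z≤n
length-concatMap≤ {f = f} {c} f≤ (x ∷ xs) = begin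
  length (f x ++ concatMap f xs)           ≡⟨ List.length-++ (f x) ⟩
  length (f x) + length (concatMap f xs)   ≤⟨ ℕ.+-mono-≤ (f≤ x) (length-concatMap≤ f≤ xs) ⟩
  c + c * length xs                        ≡⟨ ℕ.*-suc c (length xs) ⟨
  c * suc (length xs)                      ∎
  where open ℕ.≤-Reasoning

nestedCodes≤2 : ∀ xs → length (nestedCodes xs) ≤ 2
nestedCodes≤2 []                          = ℕ.z≤n
nestedCodes≤2 (_ ∷ [])                    = ℕ.z≤n
nestedCodes≤2 (_ ∷ _ ∷ [])                = ℕ.z≤n
nestedCodes≤2 (_ ∷ _ ∷ _ ∷ [])            = ℕ.z≤n
nestedCodes≤2 (_ ∷ _ ∷ _ ∷ _ ∷ [])        = ℕ.≤-refl
nestedCodes≤2 (_ ∷ _ ∷ _ ∷ _ ∷ _ ∷ _)     = ℕ.z≤n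

adjacentCodes≤2 : ∀ xs → length (adjacentCodes xs) ≤ 2
adjacentCodes≤2 []                        = ℕ.z≤n
adjacentCodes≤2 (_ ∷ [])                  = ℕ.z≤n
adjacentCodes≤2 (_ ∷ _ ∷ [])              = ℕ.z≤n
adjacentCodes≤2 (_ ∷ _ ∷ _ ∷ [])          = ℕ.z≤n
adjacentCodes≤2 (_ ∷ _ ∷ _ ∷ _ ∷ [])      = ℕ.≤-refl
adjacentCodes≤2 (_ ∷ _ ∷ _ ∷ _ ∷ _ ∷ _)   = ℕ.z≤n

alternatingCodes≤2 : ∀ xs → length (alternatingCodes xs) ≤ 2
alternatingCodes≤2 []                      = ℕ.z≤n
alternatingCodes≤2 (_ ∷ [])                = ℕ.z≤n
alternatingCodes≤2 (_ ∷ _ ∷ [])            = ℕ.z≤n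
alternatingCodes≤2 (_ ∷ _ ∷ _ ∷ [])        = ℕ.z≤n
alternatingCodes≤2 (_ ∷ _ ∷ _ ∷ _ ∷ [])    = ℕ.≤-refl
alternatingCodes≤2 (_ ∷ _ ∷ _ ∷ _ ∷ _ ∷ _) = ℕ.z≤n

length-chains₂ : ∀ w n → length (chains₂ w n) ≡
  count (w 0ℙ 0ℙ) n + (count (w 0ℙ 1ℙ) n + (count (w 1ℙ 0ℙ) n + count (w 1ℙ 1ℙ) n))
length-chains₂ w n = ≡.trans (List.length-++ (chains (w 0ℙ 0ℙ) n)) (≡.cong (count (w 0ℙ 0ℙ) n +_)
  (≡.trans (List.length-++ (chains (w 0ℙ 1ℙ) n)) (≡.cong (count (w 0ℙ 1ℙ) n +_) (List.length-++ (chains (w 1ℙ 0ℙ) n)))))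

length-codes≤ : ∀ n → length (codes n) ≤ 4 * Q (λ w → count w n)
length-codes≤ n = begin
  length (codes n)
    ≡⟨ List.length-++ (concatMap nestedCodes ns) ⟩
  length (concatMap nestedCodes ns) + length (concatMap adjacentCodes as ++ concatMap alternatingCodes ls)
    ≡⟨ ≡.cong (length (concatMap nestedCodes ns) +_) (List.length-++ (concatMap adjacentCodes as)) ⟩
  length (concatMap nestedCodes ns) + (length (concatMap adjacentCodes as) + length (concatMap alternatingCodes ls))
    ≤⟨ ℕ.+-mono-≤ (length-concatMap≤ nestedCodes≤2 ns)
         (ℕ.+-mono-≤ (length-concatMap≤ adjacentCodes≤2 as) (length-concatMap≤ alternatingCodes≤2 ls)) ⟩
  2 * length ns + (2 * length as + 2 * length ls)
    ≡⟨ ≡.cong₂ (λ x y → 2 * x + y) (length-chains₂ nestedWord n)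
         (≡.cong₂ (λ x y → 2 * x + 2 * y) (length-chains₂ adjacentWord n) (length-chains₂ alternatingWord n)) ⟩
  _
    -- The twelve counts pair up: 0000 and 1111 are nested and adjacent, 0110 and 1001 nested and
    -- alternating, 0011 and 1100 adjacent and alternating.
    ≡⟨ regroup (count (0ℙ ∷ 0ℙ ∷ [00]) n) (count (0ℙ ∷ 1ℙ ∷ [10]) n) (count (1ℙ ∷ 0ℙ ∷ [01]) n)
         (count (1ℙ ∷ 1ℙ ∷ [11]) n) (count (0ℙ ∷ 0ℙ ∷ [11]) n) (count (1ℙ ∷ 1ℙ ∷ [00]) n) ⟩
  4 * Q (λ w → count w n) ∎
  where
  open ℕ.≤-Reasoning
  ns = chains₂ nestedWord n
  as = chains₂ adjacentWord n
  ls = chains₂ alternatingWord n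
  regroup : ∀ p q r s t u →
    2 * (p + (q + (r + s))) + (2 * (p + (t + (u + s))) + 2 * (t + (q + (r + u)))) ≡ 4 * (p + t + q + (r + u + s))
  regroup = solve-∀

bound : ℕ → ℕ
bound n = ⌊ n /2⌋ * ⌊ n ∸ 1 /2⌋ * ⌊ n ∸ 2 /2⌋ * ⌊ n ∸ 3 /2⌋

-- The four floors are m, m - 1, m - 1, m - 2 for n = 2m and m, m, m - 1, m - 1 for n = 2m + 1,
-- exactly the factors of the closed forms. For n ≤ 2 there are no quadruples.
4Q≤bound : ∀ n → 4 * Q (λ w → count w n) ≤ bound n
4Q≤bound n with halved n
... | even zero          = ℕ.≤-refl
... | even (suc zero)    = ℕ.≤-refl
... | even (suc (suc k)) = ℕ.≤-reflexive (≡.trans (Q-even-closed k) (≡.sym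
  (≡.cong₂ _*_ (≡.cong₂ _*_ (≡.cong₂ _*_ (half-twice (suc (suc k))) (half-1+twice (suc k)))
    (half-twice (suc k))) (half-1+twice k))))
... | odd zero           = ℕ.≤-refl
... | odd (suc k)        = ℕ.≤-reflexive (≡.trans (Q-odd-closed k) (≡.sym
  (≡.cong₂ _*_ (≡.cong₂ _*_ (≡.cong₂ _*_ (half-1+twice (suc k)) (half-twice (suc k)))
    (half-1+twice k)) (half-twice k))))

weaken : ∀ {ℝ G c d} → c ≤ d → CrossingNumberAtMost ℝ G c → CrossingNumberAtMost ℝ G d
weaken c≤d atMost = record
  { drawing = let drawn , k , h , k≤c = drawing in drawn , k , h , ℕ.≤-trans k≤c c≤d
  ; bound   = λ m isCr → ℕ.≤-trans (CrossingNumberAtMost.bound atMost m isCr) c≤d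
  }
  where open CrossingNumberAtMost atMost using (drawing)

theorem2p1 : (ℝ : RealField) (n : ℕ) → n ≥ 1 →
    CrossingNumberAtMost ℝ (Kₙₙ-nK₂ n)
    (⌊ n /2⌋ * ⌊ n ∸ 1 /2⌋ * ⌊ n ∸ 2 /2⌋ * ⌊ n ∸ 3 /2⌋)
theorem2p1 ℝ n _ = weaken (ℕ.≤-trans (length-codes≤ n) (4Q≤bound n)) (crossingNumber≤codes ℝ n)
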